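{- If $q$ is a power of an odd prime, then $\chi(G_{q^3})\le 6q^2$; consequently $\chi(ER_{q^3})\le 6q^2+1$.
   Context: For a power $Q$ of an odd prime, the graph $G_Q$ has vertex set $\mathbb{F}_Q\times\mathbb{F}_Q$, and distinct vertices $(x_1,x_2)$, $(y_1,y_2)$ are adjacent if and only if $(x_1+y_1)^2=x_2+y_2$; $G_Q$ has no loops. $ER_Q$ is the graph whose vertices are the $1$-dimensional subspaces of $\mathbb{F}_Q^3$, where distinct vertices $(x_0,x_1,x_2)$, $(y_0,y_1,y_2)$ (homogeneous coordinates) are adjacent if and only if $x_0y_0+x_1y_1+x_2y_2=0$. $\chi$ denotes the chromatic number. -}

module Defs where

open import Level using (_⊔_) renaming (suc to lsuc)
open import Algebra.Apartness.Bundles using (HeytingField; HeytingCommutativeRing)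
open import Algebra.Bundles using (CommutativeRing)
import Algebra.Properties.Semiring.Exp as Exp
open import Data.Fin.Base using (Fin)
open import Data.Fin.Patterns using (0F; 1F; 2F)
open import Data.Nat.Base as ℕ using (ℕ)
open import Data.Nat.Primality using (Prime)
open import Data.Product.Base using (Σ; ∃-syntax; ∃₂; _×_; _,_; proj₁; swap)
open import Data.Product.Relation.Binary.Pointwise.NonDependent using (×-setoid)
open import Data.Vec.Functional using (Vector)
open import Function.Base using (_∘_)
open import Function.Bundles using (Func; Inverse)
open import Relation.Binary.Bundles using (Setoid)
open import Relation.Binary.Core using (Rel)
open import Relation.Binary.Definitions using (Symmetric; Irreflexive; _Respectsʳ_)
open import Relation.Binary.PropositionalEquality as ≡ using (_≡_; _≢_)
open import Relation.Nullary.Negation using (¬_)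
import Relation.Binary.Reasoning.Setoid as ≈-Reasoning

IsOddPrimePower : ℕ → Set
IsOddPrimePower q = ∃₂ λ p k → Prime p × p ≢ 2 × 0 ℕ.< k × q ≡ p ℕ.^ k

-- The vertices form a setoid so that points of a projective plane can be
-- represented by vectors up to scaling.  Respecting _≈_ on the left follows
-- from adj-respʳ and adj-sym.
record Graph v ℓ e : Set (lsuc (v ⊔ ℓ ⊔ e)) where
  field
    vertices : Setoid v ℓ
  open Setoid vertices public using () renaming (Carrier to Vertex; _≈_ to _≈ᵥ_)
  field
    Adj        : Rel Vertex e
    adj-sym    : Symmetric Adj
    adj-irrefl : Irreflexive _≈ᵥ_ Adj
    adj-respʳ  : Adj Respectsʳ _≈ᵥ_

module _ {v ℓ e} (G : Graph v ℓ e) where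
  open Graph G

  Colourable : ℕ → Set (v ⊔ ℓ ⊔ e)
  Colourable k = Σ (Func vertices (≡.setoid (Fin k))) λ f →
    ∀ {x y} → Adj x y → Func.to f x ≢ Func.to f y

  IsChromaticNumber : ℕ → Set (v ⊔ ℓ ⊔ e)
  IsChromaticNumber n = Colourable n × (∀ m → Colourable m → n ℕ.≤ m)

infix 4 χ_≤_

χ_≤_ : ∀ {v ℓ e} → Graph v ℓ e → ℕ → Set (v ⊔ ℓ ⊔ e)
χ G ≤ k = ∃[ n ] IsChromaticNumber G n × n ℕ.≤ k

module _ {c ℓ₁ ℓ₂} (F : HeytingField c ℓ₁ ℓ₂) where
  open CommutativeRing
    (HeytingCommutativeRing.commutativeRing (HeytingField.heytingCommutativeRing F))
  open Exp semiring using (_^_; ^-congˡ)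

  -- With finitely many elements, _≈_ is decidable and the apartness x # y is
  -- equivalent to ¬ (x ≈ y), so the Heyting fields of order n are exactly
  -- the fields with n elements in the usual sense.
  HasOrder : ℕ → Set (c ⊔ ℓ₁)
  HasOrder n = Inverse setoid (≡.setoid (Fin n))

  plane : Setoid c ℓ₁
  plane = ×-setoid setoid setoid

  open Setoid plane using () renaming (_≈_ to _≈₂_)

  AdjG : Rel (Carrier × Carrier) ℓ₁
  AdjG x@(x₁ , x₂) y@(y₁ , y₂) = ¬ (x ≈₂ y) × (x₁ + y₁) ^ 2 ≈ x₂ + y₂

  graphG : Graph c ℓ₁ ℓ₁
  graphG = record
    { vertices   = plane
    ; Adj        = AdjG
    ; adj-sym    = λ {x} {y} (x≉y , eq) →
        (λ y≈x → x≉y (Setoid.sym plane {y} {x} y≈x)) ,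
        trans (^-congˡ 2 (+-comm _ _)) (trans eq (+-comm _ _))
    ; adj-irrefl = λ x≈y (x≉y , _) → x≉y x≈y
    ; adj-respʳ  = λ {x} {y} {z} y≈z@(y₁≈z₁ , y₂≈z₂) (x≉y , eq) →
        (λ x≈z → x≉y (Setoid.trans plane {x} {z} {y} x≈z (Setoid.sym plane {y} {z} y≈z))) ,
        trans (^-congˡ 2 (+-congˡ (sym y₁≈z₁))) (trans eq (+-congˡ y₂≈z₂))
    }

  infix 7 _·_

  _·_ : Vector Carrier 3 → Vector Carrier 3 → Carrier
  x · y = x 0F * y 0F + x 1F * y 1F + x 2F * y 2F

  -- A one-dimensional subspace of F³, given by a spanning vector.
  Line : Set (c ⊔ ℓ₁)
  Line = Σ (Vector Carrier 3) λ x → ¬ (∀ i → x i ≈ 0#)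

  _∈⟨_⟩ : Vector Carrier 3 → Vector Carrier 3 → Set (c ⊔ ℓ₁)
  x ∈⟨ y ⟩ = ∃[ s ] ∀ i → x i ≈ s * y i

  -- Equality of the spanned subspaces: each contains the generator of the other.
  _≈ₗ_ : Rel Line (c ⊔ ℓ₁)
  (x , _) ≈ₗ (y , _) = x ∈⟨ y ⟩ × y ∈⟨ x ⟩

  ∈-refl : ∀ {x} → x ∈⟨ x ⟩
  ∈-refl = 1# , λ i → sym (*-identityˡ _)

  ∈-trans : ∀ {x y z} → x ∈⟨ y ⟩ → y ∈⟨ z ⟩ → x ∈⟨ z ⟩
  ∈-trans (s , x≈sy) (t , y≈tz) = s * t , λ i →
    trans (x≈sy i) (trans (*-congˡ (y≈tz i)) (sym (*-assoc s t _)))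

  lines : Setoid (c ⊔ ℓ₁) (c ⊔ ℓ₁)
  lines = record
    { Carrier       = Line
    ; _≈_           = _≈ₗ_
    ; isEquivalence = record
      { refl  = ∈-refl , ∈-refl
      ; sym   = swap
      ; trans = λ (p , p′) (q , q′) → ∈-trans p q , ∈-trans q′ p′
      }
    }

  AdjER : Rel Line (c ⊔ ℓ₁)
  AdjER x y = ¬ (x ≈ₗ y) × proj₁ x · proj₁ y ≈ 0#

  ·-comm : ∀ x y → x · y ≈ y · x
  ·-comm x y = +-cong (+-cong (*-comm _ _) (*-comm _ _)) (*-comm _ _)

  ⊥-resp-∈ : ∀ x {y z} → z ∈⟨ y ⟩ → x · y ≈ 0# → x · z ≈ 0#
  ⊥-resp-∈ x {y} {z} (s , z≈sy) x·y≈0 = begin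
    x · z                                          ≈⟨ +-cong (+-cong (pull 0F) (pull 1F)) (pull 2F) ⟩
    s * (x 0F * y 0F) + s * (x 1F * y 1F) + s * (x 2F * y 2F)
                                                   ≈⟨ +-congʳ (distribˡ s _ _) ⟨
    s * (x 0F * y 0F + x 1F * y 1F) + s * (x 2F * y 2F)
                                                   ≈⟨ distribˡ s _ _ ⟨
    s * (x · y)                                    ≈⟨ *-congˡ x·y≈0 ⟩
    s * 0#                                         ≈⟨ zeroʳ s ⟩
    0#                                             ∎
    where
    open ≈-Reasoning setoid
    pull : ∀ i → x i * z i ≈ s * (x i * y i)
    pull i = begin
      x i * z i       ≈⟨ *-congˡ (z≈sy i) ⟩
      x i * (s * y i) ≈⟨ *-assoc _ _ _ ⟨
      x i * s * y i   ≈⟨ *-congʳ (*-comm _ _) ⟩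
      s * x i * y i   ≈⟨ *-assoc _ _ _ ⟩
      s * (x i * y i) ∎

  graphER : Graph (c ⊔ ℓ₁) (c ⊔ ℓ₁) (c ⊔ ℓ₁)
  graphER = record
    { vertices   = lines
    ; Adj        = AdjER
    ; adj-sym    = λ {x} {y} (x≉y , eq) →
        x≉y ∘ swap , trans (·-comm (proj₁ y) (proj₁ x)) eq
    ; adj-irrefl = λ x≈y (x≉y , _) → x≉y x≈y
    ; adj-respʳ  = λ {x} {y} {z} y≈z@(_ , z∈y) (x≉y , eq) →
        (λ x≈z → x≉y (Setoid.trans lines {x} {z} {y} x≈z (swap y≈z))) ,
        ⊥-resp-∈ (proj₁ x) z∈y eq
    }

{-# OPTIONS --safe #-}

-- Put a = x₂ - x₁², so that adjacency in G_Q reads 2xy = a + b.  For Q = q³ and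
-- x ≠ 0 let z = x^(q-1), a root of unity of order dividing M = q² + q + 1.  The
-- additive map a ↦ a^q - z²a kills xy whenever x and y belong to the same z, so
-- the points where it does not vanish are coloured by z and by which of the two
-- opposite values ±(a^q - z²a) occurs.  On the remaining points adjacency forces
-- the same z, so q² colours, shared by all z, separate the pairs (x, a) of roots
-- of X^q = zX and X^q = z²X; the origin gets its own colour.  In total
-- 2M + q² + 1 ≤ 6q².
--
-- ER_Q is G_Q together with a line at infinity, whose points other than the pole
-- are pairwise non-adjacent, while the pole is adjacent to no affine point.
module Submission where

open import Defs
open import Level using (_⊔_)
open import Algebra.Apartness.Bundles using (HeytingField; HeytingCommutativeRing)
import Algebra.Apartness.Properties.HeytingCommutativeRing as HeytingProperties
open import Algebra.Bundles using (CommutativeRing)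
import Algebra.Properties.AbelianGroup as AbelianGroupProperties
import Algebra.Properties.CommutativeMonoid.Sum as Sum
import Algebra.Properties.CommutativeSemiring.Binomial as Binomial
import Algebra.Properties.CommutativeSemiring.Exp as Exp
import Algebra.Properties.Ring as RingProperties
import Algebra.Properties.Semiring.Mult as Mult
import Algebra.Properties.Semiring.Mult.TCOptimised as OptimisedMult
import Algebra.Solver.Ring as RingSolver
open import Algebra.Solver.Ring.AlmostCommutativeRing using (fromCommutativeRing; _-Raw-AlmostCommutative⟶_)
open import Data.Fin.Base as Fin
  using (Fin; zero; suc; toℕ; inject≤; punchIn; combine; remQuot; finToFun; funToFin; join; splitAt)
open import Data.Fin.Patterns using (0F; 1F; 2F)
open import Data.Fin.Permutation as Perm
  using (Permutation; permutation; _⟨$⟩ʳ_; remove; insert-remove; insert-punchIn)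
import Data.Fin.Properties as Fin
open import Data.Integer.Base as ℤ using (ℤ; +_; -[1+_]; _⊖_)
import Data.Integer.Properties as ℤ
open import Data.List.Base using (List; []; _∷_; length; filter; allFin)
open import Data.List.Membership.Propositional using (_∈_)
open import Data.List.Membership.Propositional.Properties using (∈-filter⁺; ∈-allFin)
open import Data.List.Membership.Setoid.Properties using (index-injective)
open import Data.List.Relation.Unary.All as All using (All; []; _∷_)
open import Data.List.Relation.Unary.All.Properties using (all-filter)
import Data.List.Relation.Unary.Any as Any
open import Data.List.Relation.Unary.Unique.Propositional using (Unique; []; _∷_)
open import Data.List.Relation.Unary.Unique.Propositional.Properties using (filter⁺; allFin⁺)
open import Data.Maybe.Base using (Maybe; just; nothing)
open import Data.Nat.Base as ℕ using (ℕ; zero; suc; z≤n; s≤s; _!)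
open import Data.Nat.Combinatorics using (_C_; nCn≡1; nCk≡nC[n∸k]; nCk≡n!/k![n-k]!; k![n∸k]!∣n!)
open import Data.Nat.Divisibility using (_∣_; _∤_; divides; ∣⇒≤; m∣m*n; ∣1⇒≡1; m%n≡0⇒n∣m)
import Data.Nat.DivMod as ℕ
open import Data.Nat.Induction using (<-wellFounded)
open import Data.Nat.Primality using (Prime; euclidsLemma; prime⇒nonTrivial; prime⇒irreducible; ¬prime[0])
import Data.Nat.Properties as ℕ
open import Data.Nat.Solver using (module +-*-Solver)
open import Data.Product.Base using (_×_; _,_; ∃-syntax; ∃₂; proj₁; proj₂)
open import Data.Sum.Base using (_⊎_; inj₁; inj₂; [_,_]′)
open import Data.Sum.Function.Propositional using (_⊎-↔_)
open import Data.Sum.Properties using (inj₁-injective; inj₂-injective)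
open import Data.Vec.Base using (Vec; []; _∷_; replicate)
open import Data.Vec.Functional using (Vector; init; tail; last)
open import Function.Base using (_∘_)
open import Function.Bundles using (Func; Inverse; _↔_)
open import Function.Construct.Composition using (_↔-∘_)
open import Function.Construct.Identity using (↔-id)
open import Induction.WellFounded using (Acc; acc)
open import Relation.Binary.Bundles using (Setoid)
open import Relation.Binary.Definitions using (Decidable)
open import Relation.Binary.PropositionalEquality as ≡ using (_≡_; _≢_)
import Relation.Binary.Reasoning.Setoid as ≈-Reasoning
open import Relation.Nullary using (¬_; Dec; yes; no; contradiction)
open import Relation.Nullary.Decidable using (map′; ¬?; _×-dec_; _→-dec_)

-- Everything about G_Q rests on one identity: since the q-th power is additive and multiplicative,
-- 2xy = a + b with x^q = zx and y^q = wy gives a^q + b^q = zw(a + b). For z = w it relates the two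
-- generic values; for special points it becomes an equation in z and w alone, up to factors that
-- may vanish. Those factors are the obstacle. At the origin they do vanish: its neighbours are the
-- other points with a = 0, and these occur for many z, so it cannot share a colour with the special
-- points. Elsewhere M = 1 + q(q + 1) makes z recoverable from z^(q+1), which is where the cubic
-- degree enters.
--
-- For ER_Q the dot product has to be brought into a form with an isotropic vector before G_Q
-- appears as its affine part; a solution of 1 + a² + b² = 0 supplies that vector.
--
-- A colouring alone does not establish `χ_≤_`, which also asserts that a least number of colours
-- exists. Colourability is therefore decided by exhaustive search.

prime∤! : ∀ {p} → Prime p → ∀ {k} → k ℕ.< p → p ∤ k !
prime∤! pr {zero} k<p p∣1 = contradiction (∣1⇒≡1 p∣1) (ℕ.>⇒≢ (ℕ.nonTrivial⇒n>1 _ {{prime⇒nonTrivial pr}}))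
prime∤! pr {suc k} k<p p∣k! with euclidsLemma (suc k) (k !) pr p∣k!
... | inj₁ p∣k  = contradiction k<p (ℕ.≤⇒≯ (∣⇒≤ p∣k))
... | inj₂ p∣k! = prime∤! pr (ℕ.<-trans (ℕ.n<1+n k) k<p) p∣k!

-- The product of p C k with k! (p - k)! is p!, which p divides, while p divides neither factorial.
prime∣C : ∀ {p} → Prime p → ∀ {k} → 0 ℕ.< k → k ℕ.< p → p ∣ p C k
prime∣C {suc p-1} pr {suc j} 0<k k<p with euclidsLemma _ _ pr p∣C*d
  where
  p = suc p-1
  k = suc j
  d = k ! ℕ.* (p ℕ.∸ k) !
  instance d≢0 = k ℕ.!* (p ℕ.∸ k) !≢0
  p∣C*d : p ∣ (p C k) ℕ.* d
  p∣C*d = ≡.subst (p ∣_)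
    (≡.sym (≡.trans (≡.cong (ℕ._* d) (nCk≡n!/k![n-k]! (ℕ.<⇒≤ k<p))) (ℕ.m/n*n≡m (k![n∸k]!∣n! (ℕ.<⇒≤ k<p)))))
    (m∣m*n (p-1 !))
... | inj₁ p∣C = p∣C
... | inj₂ p∣d with euclidsLemma (suc j !) _ pr p∣d
...   | inj₁ p∣k!     = contradiction p∣k! (prime∤! pr k<p)
...   | inj₂ p∣[p∸k]! = contradiction p∣[p∸k]! (prime∤! pr (s≤s (ℕ.m∸n≤m p-1 j)))

-- Integer coefficients for the ring solver, and additivity of Frobenius.

module CommutativeRingLemmas {c ℓ} (R : CommutativeRing c ℓ) where
  open CommutativeRing R hiding (zero)
  open Exp commutativeSemiring public
  open Mult semiring using (×-homo-+; ×1-homo-*; ×-congʳ; ×-assoc-*)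
    renaming (_×_ to infixr 8 _×ⁿ_) public
  open RingProperties ring public using (-‿involutive; -0#≈0#; -‿distribˡ-*; -‿distribʳ-*)
  open AbelianGroupProperties +-abelianGroup public using (⁻¹-∙-comm)
  open ≈-Reasoning setoid

  private module Mult′ = OptimisedMult semiring
  open Mult′ using (1+×) renaming (_×_ to infixr 8 _×′_)

  -- The optimised multiple makes ⟦ + 1 ⟧ᶻ and ⟦ + 2 ⟧ᶻ compute to 1# and 1# + 1#.
  ⟦_⟧ᶻ : ℤ → Carrier
  ⟦ + n      ⟧ᶻ = n ×′ 1#
  ⟦ -[1+ n ] ⟧ᶻ = - (suc n ×′ 1#)

  ⟦⊖⟧ : ∀ m n → ⟦ m ⊖ n ⟧ᶻ ≈ m ×′ 1# - n ×′ 1#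
  ⟦⊖⟧ m       zero    = sym (trans (+-congˡ -0#≈0#) (+-identityʳ _))
  ⟦⊖⟧ zero    (suc n) = sym (+-identityˡ _)
  ⟦⊖⟧ (suc m) (suc n) = begin
    ⟦ suc m ⊖ suc n ⟧ᶻ                ≡⟨ ≡.cong ⟦_⟧ᶻ (ℤ.[1+m]⊖[1+n]≡m⊖n m n) ⟩
    ⟦ m ⊖ n ⟧ᶻ                        ≈⟨ ⟦⊖⟧ m n ⟩
    m ×′ 1# - n ×′ 1#                 ≈⟨ +-congʳ (+-identityˡ _) ⟨
    0# + m ×′ 1# - n ×′ 1#            ≈⟨ +-congʳ (+-congʳ (-‿inverseʳ 1#)) ⟨
    1# - 1# + m ×′ 1# - n ×′ 1#       ≈⟨ +-congʳ (+-assoc _ _ _) ⟩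
    1# + (- 1# + m ×′ 1#) - n ×′ 1#   ≈⟨ +-congʳ (+-congˡ (+-comm _ _)) ⟩
    1# + (m ×′ 1# - 1#) - n ×′ 1#     ≈⟨ +-congʳ (+-assoc _ _ _) ⟨
    1# + m ×′ 1# - 1# - n ×′ 1#       ≈⟨ +-assoc _ _ _ ⟩
    1# + m ×′ 1# + (- 1# - n ×′ 1#)   ≈⟨ +-congˡ (⁻¹-∙-comm _ _) ⟩
    1# + m ×′ 1# - (1# + n ×′ 1#)     ≈⟨ +-cong (1+× m 1#) (-‿cong (1+× n 1#)) ⟨
    suc m ×′ 1# - suc n ×′ 1#         ∎

  ⟦+⟧ : ∀ i j → ⟦ i ℤ.+ j ⟧ᶻ ≈ ⟦ i ⟧ᶻ + ⟦ j ⟧ᶻ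
  ⟦+⟧ (+ m)      (+ n)      = Mult′.×-homo-+ 1# m n
  ⟦+⟧ (+ m)      (-[1+ n ]) = ⟦⊖⟧ m (suc n)
  ⟦+⟧ (-[1+ m ]) (+ n)      = trans (⟦⊖⟧ n (suc m)) (+-comm _ _)
  ⟦+⟧ (-[1+ m ]) (-[1+ n ]) = begin
    - (suc (suc (m ℕ.+ n)) ×′ 1#)   ≡⟨ ≡.cong (λ k → - (suc k ×′ 1#)) (ℕ.+-suc m n) ⟨
    - ((suc m ℕ.+ suc n) ×′ 1#)     ≈⟨ -‿cong (Mult′.×-homo-+ 1# (suc m) (suc n)) ⟩
    - (suc m ×′ 1# + suc n ×′ 1#)   ≈⟨ ⁻¹-∙-comm _ _ ⟨
    - (suc m ×′ 1#) - suc n ×′ 1#   ∎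

  ⟦-⟧ : ∀ i → ⟦ ℤ.- i ⟧ᶻ ≈ - ⟦ i ⟧ᶻ
  ⟦-⟧ (+ zero)   = sym -0#≈0#
  ⟦-⟧ (+ suc n)  = refl
  ⟦-⟧ (-[1+ n ]) = sym (-‿involutive _)

  ⟦+*⟧ : ∀ m j → ⟦ + m ℤ.* j ⟧ᶻ ≈ m ×′ 1# * ⟦ j ⟧ᶻ
  ⟦+*⟧ m (+ n)      = begin
    ⟦ + m ℤ.* + n ⟧ᶻ      ≡⟨ ≡.cong ⟦_⟧ᶻ (ℤ.pos-* m n) ⟨
    (m ℕ.* n) ×′ 1#       ≈⟨ Mult′.×1-homo-* m n ⟩
    m ×′ 1# * (n ×′ 1#)   ∎
  ⟦+*⟧ m (-[1+ n ]) = begin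
    ⟦ + m ℤ.* -[1+ n ] ⟧ᶻ       ≡⟨ ≡.cong ⟦_⟧ᶻ (ℤ.neg-distribʳ-* (+ m) (+ suc n)) ⟨
    ⟦ ℤ.- (+ m ℤ.* + suc n) ⟧ᶻ  ≈⟨ ⟦-⟧ (+ m ℤ.* + suc n) ⟩
    - ⟦ + m ℤ.* + suc n ⟧ᶻ      ≡⟨ ≡.cong (λ i → - ⟦ i ⟧ᶻ) (ℤ.pos-* m (suc n)) ⟨
    - ((m ℕ.* suc n) ×′ 1#)     ≈⟨ -‿cong (Mult′.×1-homo-* m (suc n)) ⟩
    - (m ×′ 1# * (suc n ×′ 1#)) ≈⟨ -‿distribʳ-* _ _ ⟩
    m ×′ 1# * - (suc n ×′ 1#)   ∎

  ⟦*⟧ : ∀ i j → ⟦ i ℤ.* j ⟧ᶻ ≈ ⟦ i ⟧ᶻ * ⟦ j ⟧ᶻ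
  ⟦*⟧ (-[1+ m ]) j = begin
    ⟦ -[1+ m ] ℤ.* j ⟧ᶻ         ≡⟨ ≡.cong ⟦_⟧ᶻ (ℤ.neg-distribˡ-* (+ suc m) j) ⟨
    ⟦ ℤ.- (+ suc m ℤ.* j) ⟧ᶻ    ≈⟨ ⟦-⟧ (+ suc m ℤ.* j) ⟩
    - ⟦ + suc m ℤ.* j ⟧ᶻ        ≈⟨ -‿cong (⟦+*⟧ (suc m) j) ⟩
    - (suc m ×′ 1# * ⟦ j ⟧ᶻ)    ≈⟨ -‿distribˡ-* _ _ ⟩
    - (suc m ×′ 1#) * ⟦ j ⟧ᶻ    ∎
  ⟦*⟧ (+ m)      j = ⟦+*⟧ m j

  -- Lets the solver compare coefficients as integers, so that terms cancel without deciding
  -- equality in the ring.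
  ℤ⟶R : ℤ.+-*-rawRing -Raw-AlmostCommutative⟶ fromCommutativeRing R
  ℤ⟶R = record
    { ⟦_⟧    = ⟦_⟧ᶻ
    ; +-homo = ⟦+⟧
    ; *-homo = ⟦*⟧
    ; -‿homo = ⟦-⟧
    ; 0-homo = refl
    ; 1-homo = refl
    }

  private
    ⟦⟧≟ : ∀ i j → Maybe (⟦ i ⟧ᶻ ≈ ⟦ j ⟧ᶻ)
    ⟦⟧≟ i j with i ℤ.≟ j
    ... | yes ≡.refl = just refl
    ... | no  _      = nothing

  module Solver = RingSolver ℤ.+-*-rawRing (fromCommutativeRing R) ℤ⟶R ⟦⟧≟

  module Frobenius {p} (pr : Prime p) (p×1≈0 : p ×ⁿ 1# ≈ 0#) where
    open Binomial commutativeSemiring using (theorem; binomialTerm)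
    open Sum +-commutativeMonoid using (sum; sum-cong-≋; sum-replicate-zero; sum-init-last)

    multiple×≈0 : ∀ {m} → p ∣ m → ∀ x → m ×ⁿ x ≈ 0#
    multiple×≈0 (divides d ≡.refl) x = begin
      (d ℕ.* p) ×ⁿ x           ≈⟨ ×-congʳ (d ℕ.* p) (*-identityˡ x) ⟨
      (d ℕ.* p) ×ⁿ (1# * x)    ≈⟨ ×-assoc-* (d ℕ.* p) 1# x ⟨
      (d ℕ.* p) ×ⁿ 1# * x      ≈⟨ *-congʳ (×1-homo-* d p) ⟩
      d ×ⁿ 1# * (p ×ⁿ 1#) * x ≈⟨ *-congʳ (*-congˡ p×1≈0) ⟩
      d ×ⁿ 1# * 0# * x       ≈⟨ *-congʳ (zeroʳ _) ⟩
      0# * x                ≈⟨ zeroˡ x ⟩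
      0#                    ∎

    ^p-distrib-+ : ∀ x y → (x + y) ^ p ≈ x ^ p + y ^ p
    ^p-distrib-+ x y = go p pr multiple×≈0
      where
      -- The prime is abstracted together with the vanishing of its multiples, so that it can be
      -- matched as `suc p′`.
      go : ∀ p → Prime p → (∀ {m} → p ∣ m → ∀ x → m ×ⁿ x ≈ 0#) → (x + y) ^ p ≈ x ^ p + y ^ p
      go zero     pr _ = contradiction pr ¬prime[0]
      go (suc p′) pr vanish = begin
        (x + y) ^ suc p′                             ≈⟨ theorem (suc p′) x y ⟩
        t zero + sum (tail t)                        ≈⟨ +-congˡ (sum-init-last (tail t)) ⟩
        t zero + (sum (init (tail t)) + last (tail t)) ≈⟨ +-cong first (+-cong middle final) ⟩
        y ^ suc p′ + (0# + x ^ suc p′)               ≈⟨ +-congˡ (+-identityˡ _) ⟩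
        y ^ suc p′ + x ^ suc p′                      ≈⟨ +-comm _ _ ⟩
        x ^ suc p′ + y ^ suc p′                      ∎
        where
        t = binomialTerm x y (suc p′)
        C0≡1 : suc p′ C 0 ≡ 1
        C0≡1 = ≡.trans (nCk≡nC[n∸k] {k = 0} {n = suc p′} z≤n) (nCn≡1 (suc p′))
        first : t zero ≈ y ^ suc p′
        first = begin
          (suc p′ C 0) ×ⁿ (1# * y ^ suc p′) ≡⟨ ≡.cong (_×ⁿ (1# * y ^ suc p′)) C0≡1 ⟩
          1# * y ^ suc p′ + 0#             ≈⟨ +-identityʳ _ ⟩
          1# * y ^ suc p′                  ≈⟨ *-identityˡ _ ⟩
          y ^ suc p′                       ∎
        middle : sum (init (tail t)) ≈ 0#
        middle = trans (sum-cong-≋ λ i → vanish (prime∣C pr (s≤s z≤n) (s≤s (Fin.inject₁ℕ< i))) _)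
          (sum-replicate-zero p′)
        final : last (tail t) ≈ x ^ suc p′
        final = begin
          last (tail t)
            ≡⟨ ≡.cong (λ k → (suc p′ C suc k) ×ⁿ (x ^ suc k * y ^ (p′ ℕ.∸ k))) (Fin.toℕ-fromℕ p′) ⟩
          (suc p′ C suc p′) ×ⁿ (x ^ suc p′ * y ^ (p′ ℕ.∸ p′)) 
            ≡⟨ ≡.cong₂ (λ m k → m ×ⁿ (x ^ suc p′ * y ^ k)) (nCn≡1 (suc p′)) (ℕ.n∸n≡0 p′) ⟩
          x ^ suc p′ * 1# + 0# ≈⟨ +-identityʳ _ ⟩
          x ^ suc p′ * 1#      ≈⟨ *-identityʳ _ ⟩
          x ^ suc p′           ∎

    ^p^-distrib-+ : ∀ k x y → (x + y) ^ (p ℕ.^ k) ≈ x ^ (p ℕ.^ k) + y ^ (p ℕ.^ k)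
    ^p^-distrib-+ zero    x y = trans (*-identityʳ _) (sym (+-cong (*-identityʳ x) (*-identityʳ y)))
    ^p^-distrib-+ (suc k) x y = begin
      (x + y) ^ (p ℕ.* p ℕ.^ k)   ≈⟨ ^-assocʳ (x + y) p (p ℕ.^ k) ⟨
      ((x + y) ^ p) ^ (p ℕ.^ k)   ≈⟨ ^-congˡ (p ℕ.^ k) (^p-distrib-+ x y) ⟩
      (x ^ p + y ^ p) ^ (p ℕ.^ k) ≈⟨ ^p^-distrib-+ k _ _ ⟩
      (x ^ p) ^ (p ℕ.^ k) + (y ^ p) ^ (p ℕ.^ k) ≈⟨ +-cong (^-assocʳ x p _) (^-assocʳ y p _) ⟩
      x ^ (p ℕ.* p ℕ.^ k) + y ^ (p ℕ.* p ℕ.^ k) ∎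

-- Finite fields: decidable equality, roots of monic polynomials, characteristic.

module FiniteField {c ℓ₁ ℓ₂} (F : HeytingField c ℓ₁ ℓ₂) {n} (order : HasOrder F n) where
  commutativeRing : CommutativeRing c ℓ₁
  commutativeRing = HeytingCommutativeRing.commutativeRing (HeytingField.heytingCommutativeRing F)
  open CommutativeRing commutativeRing hiding (zero) public
  open CommutativeRingLemmas commutativeRing public
  open Inverse order public using (to; from) renaming (to-cong to toⁱ-cong)
  open HeytingField F using (_#_; #⇒invertible; tight)
  open Solver using (solve; _:=_; _:+_; _:*_; _:-_)
  open ≈-Reasoning setoid

  from-to : ∀ x → from (to x) ≈ x
  from-to x = Inverse.inverseʳ order ≡.refl

  to-from : ∀ i → to (from i) ≡ i
  to-from i = Inverse.inverseˡ order refl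

  to-injective : ∀ {x y} → to x ≡ to y → x ≈ y
  to-injective {x} {y} eq = begin
    x           ≈⟨ from-to x ⟨
    from (to x) ≡⟨ ≡.cong from eq ⟩
    from (to y) ≈⟨ from-to y ⟩
    y           ∎

  from-injective : ∀ {i j} → from i ≈ from j → i ≡ j
  from-injective {i} {j} eq = ≡.trans (≡.sym (to-from i)) (≡.trans (toⁱ-cong eq) (to-from j))

  infix 4 _≈?_
  _≈?_ : ∀ x y → Dec (x ≈ y)
  x ≈? y = map′ to-injective toⁱ-cong (to x Fin.≟ to y)

  -- Apartness does not follow directly from inequality, so an inverse is searched for among the n
  -- elements. If none is found, x cannot be apart from 0, and tightness gives x ≈ 0.
  invertible : ∀ x → ¬ x ≈ 0# → ∃[ y ] x * y ≈ 1#
  invertible x x≉0 with Fin.any? (λ i → x * from i ≈? 1#)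
  ... | yes (i , x*i≈1) = from i , x*i≈1
  ... | no  noInverse   = contradiction (proj₁ (tight x 0#) ¬x#0) x≉0
    where
    ¬x#0 : ¬ x # 0#
    ¬x#0 x#0 with #⇒invertible x#0
    ... | y , _ , x-0*y≈1 = noInverse (to y , (begin
      x * from (to y) ≈⟨ *-congˡ (from-to y) ⟩
      x * y           ≈⟨ *-congʳ (trans (+-congˡ -0#≈0#) (+-identityʳ x)) ⟨
      (x - 0#) * y    ≈⟨ x-0*y≈1 ⟩
      1#              ∎))

  1≉0 : ¬ 1# ≈ 0#
  1≉0 1≈0 = proj₂ (tight 1# 0#) 1≈0 (HeytingProperties.1#0 (HeytingField.heytingCommutativeRing F))

  *-cancelˡ : ∀ {x} → ¬ x ≈ 0# → ∀ {y z} → x * y ≈ x * z → y ≈ z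
  *-cancelˡ {x} x≉0 {y} {z} eq with w , x*w≈1 ← invertible x x≉0 = begin
    y           ≈⟨ *-identityˡ y ⟨
    1# * y      ≈⟨ *-congʳ (trans (*-comm w x) x*w≈1) ⟨
    w * x * y   ≈⟨ *-assoc w x y ⟩
    w * (x * y) ≈⟨ *-congˡ eq ⟩
    w * (x * z) ≈⟨ *-assoc w x z ⟨
    w * x * z   ≈⟨ *-congʳ (trans (*-comm w x) x*w≈1) ⟩
    1# * z      ≈⟨ *-identityˡ z ⟩
    z           ∎

  x≉0∧xy≈0⇒y≈0 : ∀ {x} → ¬ x ≈ 0# → ∀ {y} → x * y ≈ 0# → y ≈ 0#
  x≉0∧xy≈0⇒y≈0 {x} x≉0 xy≈0 = *-cancelˡ x≉0 (trans xy≈0 (sym (zeroʳ x)))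

  x*y≈0⇒x≈0∨y≈0 : ∀ x {y} → x * y ≈ 0# → x ≈ 0# ⊎ y ≈ 0#
  x*y≈0⇒x≈0∨y≈0 x xy≈0 with x ≈? 0#
  ... | yes x≈0 = inj₁ x≈0
  ... | no  x≉0 = inj₂ (x≉0∧xy≈0⇒y≈0 x≉0 xy≈0)

  x^k≈0⇒x≈0 : ∀ k {x} → x ^ k ≈ 0# → x ≈ 0#
  x^k≈0⇒x≈0 zero        1≈0    = contradiction 1≈0 1≉0
  x^k≈0⇒x≈0 (suc k) {x} x^k≈0 = [ (λ x≈0 → x≈0) , x^k≈0⇒x≈0 k ]′ (x*y≈0⇒x≈0∨y≈0 x x^k≈0)

  x-y≈0⇒x≈y : ∀ {x y} → x - y ≈ 0# → x ≈ y
  x-y≈0⇒x≈y {x} {y} x-y≈0 = begin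
    x           ≈⟨ solve 2 (λ x y → x := x :- y :+ y) refl x y ⟩
    x - y + y   ≈⟨ +-congʳ x-y≈0 ⟩
    0# + y      ≈⟨ +-identityˡ y ⟩
    y           ∎

  x≈y⇒x-y≈0 : ∀ {x y} → x ≈ y → x - y ≈ 0#
  x≈y⇒x-y≈0 {x} {y} x≈y = trans (+-congʳ x≈y) (-‿inverseʳ y)

  -- A vector of length d holds the lower coefficients, constant term first,
  -- of a monic polynomial of degree d.
  ⟦_⟧ : ∀ {d} → Vec Carrier d → Carrier → Carrier
  ⟦ []    ⟧ x = 1#
  ⟦ a ∷ p ⟧ x = a + x * ⟦ p ⟧ x

  -- Horner's scheme for division by X - r: each tail of the coefficients, evaluated at r, is a
  -- coefficient of the quotient.
  quotient : ∀ {d} → Carrier → Vec Carrier (suc d) → Vec Carrier d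
  quotient r (a ∷ [])        = []
  quotient r (a ∷ p@(_ ∷ _)) = ⟦ p ⟧ r ∷ quotient r p

  factor : ∀ {d} (p : Vec Carrier (suc d)) r x → ⟦ p ⟧ x ≈ (x - r) * ⟦ quotient r p ⟧ x + ⟦ p ⟧ r
  factor (a ∷ []) r x =
    solve 4 (λ a r x one → a :+ x :* one := (x :- r) :* one :+ (a :+ r :* one)) refl a r x 1#
  factor (a ∷ p@(_ ∷ _)) r x = begin
    a + x * ⟦ p ⟧ x
      ≈⟨ +-congˡ (*-congˡ (factor p r x)) ⟩
    a + x * ((x - r) * ⟦ quotient r p ⟧ x + ⟦ p ⟧ r)
      ≈⟨ solve 5 (λ a x r v w → a :+ x :* ((x :- r) :* v :+ w) := (x :- r) :* (w :+ x :* v) :+ (a :+ r :* w))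
           refl a x r _ _ ⟩
    (x - r) * (⟦ p ⟧ r + x * ⟦ quotient r p ⟧ x) + (a + r * ⟦ p ⟧ r) ∎

  Root : ∀ {d} → Vec Carrier d → Fin n → Set _
  Root p i = ⟦ p ⟧ (from i) ≈ 0#

  -- Divide by X - r for one root r: every other root differs from r, hence is a root of the
  -- quotient. In degree 0 the polynomial is the constant 1.
  length-roots : ∀ {d} (p : Vec Carrier d) {is} → Unique is → All (Root p) is → length is ℕ.≤ d
  length-roots p             []             []             = z≤n
  length-roots []            (_ ∷ _)        (1≈0 ∷ _)      = contradiction 1≈0 1≉0
  length-roots p@(_ ∷ _) {i ∷ is} (i∉is ∷ unique) (root-i ∷ roots) =
    s≤s (length-roots (quotient (from i) p) unique (All.zipWith other-root (i∉is , roots)))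
    where
    other-root : ∀ {j} → i ≢ j × Root p j → Root (quotient (from i) p) j
    other-root {j} (i≢j , root-j) = x≉0∧xy≈0⇒y≈0 (λ j-i≈0 → i≢j (≡.sym (from-injective (x-y≈0⇒x≈y j-i≈0)))) (begin
      (from j - from i) * ⟦ quotient (from i) p ⟧ (from j)                  ≈⟨ +-identityʳ _ ⟨
      (from j - from i) * ⟦ quotient (from i) p ⟧ (from j) + 0#             ≈⟨ +-congˡ root-i ⟨
      (from j - from i) * ⟦ quotient (from i) p ⟧ (from j) + ⟦ p ⟧ (from i) ≈⟨ factor p (from i) (from j) ⟨
      ⟦ p ⟧ (from j)                                                        ≈⟨ root-j ⟩
      0#                                                                    ∎)

  module _ {d} (p : Vec Carrier d) where
    private
      root? : ∀ i → Dec (Root p i)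
      root? i = ⟦ p ⟧ (from i) ≈? 0#

      listed : ∀ {i} → Root p i → i ∈ filter root? (allFin n)
      listed root = ∈-filter⁺ root? (∈-allFin _) root

      length≤d : length (filter root? (allFin n)) ℕ.≤ d
      length≤d = length-roots p (filter⁺ root? (allFin⁺ n)) (all-filter root? (allFin n))

    -- Names the roots of one polynomial by d colours. The underlying list depends only on `p`, so
    -- ranks of different roots can be compared.
    rank : ∀ {i} → Root p i → Fin d
    rank root = inject≤ (Any.index (listed root)) length≤d

    rank-injective : ∀ {i j} (ri : Root p i) (rj : Root p j) → rank ri ≡ rank rj → i ≡ j
    rank-injective ri rj eq = index-injective (≡.setoid (Fin n)) (listed ri) (listed rj)
      (Fin.inject≤-injective length≤d length≤d _ _ eq)

  ⟦replicate⟧ : ∀ d x → ⟦ replicate d 0# ⟧ x ≈ x ^ d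
  ⟦replicate⟧ zero    x = refl
  ⟦replicate⟧ (suc d) x = trans (+-identityˡ _) (*-congˡ (⟦replicate⟧ d x))

  -- Moves a bijection of the field to the index set, where sums and products over `Fin n` can be
  -- reindexed.
  inducedPermutation : ∀ (f g : Carrier → Carrier) →
    (∀ {x y} → x ≈ y → f x ≈ f y) → (∀ {x y} → x ≈ y → g x ≈ g y) →
    (∀ x → f (g x) ≈ x) → (∀ x → g (f x) ≈ x) → Permutation n n
  inducedPermutation f g f-cong g-cong fg gf = permutation (to ∘ f ∘ from) (to ∘ g ∘ from)
    (λ i → ≡.trans (toⁱ-cong (trans (f-cong (from-to _)) (fg _))) (to-from i))
    (λ i → ≡.trans (toⁱ-cong (trans (g-cong (from-to _)) (gf _))) (to-from i))

  -- Translation by 1 permutes the field, hence does not change the sum of all its elements.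
  n×1≈0 : n ×ⁿ 1# ≈ 0#
  n×1≈0 = begin
    n ×ⁿ 1#               ≈⟨ solve 2 (λ s t → t := (s :+ t) :- s) refl S (n ×ⁿ 1#) ⟩
    (S + n ×ⁿ 1#) - S     ≈⟨ +-congʳ (+-congˡ (sum-replicate n)) ⟨
    (S + sum {n} (λ _ → 1#)) - S ≈⟨ +-congʳ (∑-distrib-+ {n} from (λ _ → 1#)) ⟨
    sum {n} (λ i → from i + 1#) - S ≈⟨ +-congʳ (sum-cong-≋ {n} λ i → from-to (from i + 1#)) ⟨
    sum (from ∘ (shift ⟨$⟩ʳ_)) - S ≈⟨ +-congʳ (sum-permute from shift) ⟨
    S - S                 ≈⟨ -‿inverseʳ S ⟩
    0#                    ∎
    where
    open Sum +-commutativeMonoid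
    S = sum from
    shift = inducedPermutation (_+ 1#) (_- 1#) +-congʳ +-congʳ
      (λ x → solve 2 (λ x u → x :- u :+ u := x) refl x 1#)
      (λ x → solve 2 (λ x u → x :+ u :- u := x) refl x 1#)

  -- The element n · 1 vanishes and equals (p · 1)^k, and a field has no nonzero nilpotents.
  n≡p^k⇒p×1≈0 : ∀ p k → n ≡ p ℕ.^ k → p ×ⁿ 1# ≈ 0#
  n≡p^k⇒p×1≈0 p k n≡p^k = x^k≈0⇒x≈0 k (trans (sym (homo k))
    (trans (reflexive (≡.cong (_×ⁿ 1#) (≡.sym n≡p^k))) n×1≈0))
    where
    homo : ∀ k → (p ℕ.^ k) ×ⁿ 1# ≈ (p ×ⁿ 1#) ^ k
    homo zero    = +-identityʳ 1#
    homo (suc k) = trans (×1-homo-* p (p ℕ.^ k)) (*-congˡ (homo k))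

-- Multiplication by x permutes the nonzero elements, hence does not change their product.
fermat : ∀ {c ℓ₁ ℓ₂} (F : HeytingField c ℓ₁ ℓ₂) {m} (order : HasOrder F (suc m)) →
  let open FiniteField F order in ∀ x → ¬ x ≈ 0# → x ^ m ≈ 1#
fermat F {m} order x x≉0 with y , xy≈1 ← FiniteField.invertible F order x x≉0 =
  *-cancelˡ (product≉0 m nonzero nonzero≉0) (begin
    P * x ^ m                        ≈⟨ *-comm P (x ^ m) ⟩
    x ^ m * P                        ≈⟨ *-congʳ (sum-replicate m) ⟨
    sum {m} (λ _ → x) * P            ≈⟨ ∑-distrib-+ {m} (λ _ → x) nonzero ⟨
    sum (λ j → x * nonzero j)        ≈⟨ sum-cong-≋ {m} x*nonzero ⟨
    sum (nonzero ∘ (remove i₀ π ⟨$⟩ʳ_)) ≈⟨ sum-permute nonzero (remove i₀ π) ⟨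
    P                                ≈⟨ *-identityʳ P ⟨
    P * 1#                           ∎)
  where
  open FiniteField F order
  -- In the multiplicative monoid `sum` is a product and a replicated sum is a power.
  open Sum *-commutativeMonoid
  open ≈-Reasoning setoid
  i₀ = to 0#
  nonzero : Fin m → Carrier
  nonzero j = from (punchIn i₀ j)
  P = sum nonzero
  π = inducedPermutation (x *_) (y *_) *-congˡ *-congˡ
    (λ z → trans (sym (*-assoc x y z)) (trans (*-congʳ xy≈1) (*-identityˡ z)))
    (λ z → trans (sym (*-assoc y x z)) (trans (*-congʳ (trans (*-comm y x) xy≈1)) (*-identityˡ z)))
  -- As 0 is fixed, removing its index leaves a permutation of the nonzero elements.
  π-i₀ : π ⟨$⟩ʳ i₀ ≡ i₀
  π-i₀ = toⁱ-cong (trans (*-congˡ (from-to 0#)) (zeroʳ x))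
  x*nonzero : ∀ j → nonzero (remove i₀ π ⟨$⟩ʳ j) ≈ x * nonzero j
  x*nonzero j = begin
    from (punchIn i₀ (remove i₀ π ⟨$⟩ʳ j)) ≡⟨ ≡.cong (λ i → from (punchIn i (remove i₀ π ⟨$⟩ʳ j))) π-i₀ ⟨
    from (punchIn (π ⟨$⟩ʳ i₀) (remove i₀ π ⟨$⟩ʳ j)) ≡⟨ ≡.cong from (insert-punchIn i₀ (π ⟨$⟩ʳ i₀) (remove i₀ π) j) ⟨
    from (Perm.insert i₀ (π ⟨$⟩ʳ i₀) (remove i₀ π) ⟨$⟩ʳ punchIn i₀ j) ≡⟨ ≡.cong from (insert-remove i₀ π (punchIn i₀ j)) ⟩
    from (π ⟨$⟩ʳ punchIn i₀ j) ≈⟨ from-to _ ⟩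
    x * nonzero j ∎
  nonzero≉0 : ∀ j → ¬ nonzero j ≈ 0#
  nonzero≉0 j eq = Fin.punchInᵢ≢i i₀ j (≡.trans (≡.sym (to-from _)) (toⁱ-cong eq))
  product≉0 : ∀ k (f : Fin k → Carrier) → (∀ j → ¬ f j ≈ 0#) → ¬ sum f ≈ 0#
  product≉0 zero    f f≉0 = 1≉0
  product≉0 (suc k) f f≉0 eq = product≉0 k (f ∘ suc) (f≉0 ∘ suc) (x≉0∧xy≈0⇒y≈0 (f≉0 zero) eq)

-- Existence of the chromatic number of a finite graph.

least : ∀ {p} {P : ℕ → Set p} → (∀ k → Dec (P k)) → ∀ k → P k →
  ∃[ n ] (P n × (∀ m → P m → n ℕ.≤ m)) × n ℕ.≤ k
least {P = P} P? k = go k (<-wellFounded k)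
  where
  go : ∀ k → Acc ℕ._<_ k → P k → ∃[ n ] (P n × (∀ m → P m → n ℕ.≤ m)) × n ℕ.≤ k
  go k (acc rec) Pk with ℕ.anyUpTo? P? k
  ... | no  none           = k , (Pk , λ m Pm → ℕ.≮⇒≥ λ m<k → none (m , m<k , Pm)) , ℕ.≤-refl
  ... | yes (j , j<k , Pj) with n , minimal , n≤j ← go j (rec j<k) Pj =
    n , minimal , ℕ.≤-trans n≤j (ℕ.<⇒≤ j<k)

module FiniteGraph {v ℓ e} (G : Graph v ℓ e) {N}
  (vertex : Fin N → Graph.Vertex G) (index : Graph.Vertex G → Fin N)
  (vertex-index : ∀ x → Graph._≈ᵥ_ G (vertex (index x)) x)
  (_≈ᵥ?_ : Decidable (Graph._≈ᵥ_ G)) (adj? : Decidable (Graph.Adj G)) where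
  open Graph G
  private module V = Setoid vertices

  -- The enumeration may list one vertex several times, hence the first clause: equal vertices must
  -- get equal colours.
  Proper : ∀ {k} → (Fin N → Fin k) → Set _
  Proper c = ∀ i j → (vertex i ≈ᵥ vertex j → c i ≡ c j) × (Adj (vertex i) (vertex j) → c i ≢ c j)

  proper? : ∀ {k} (c : Fin N → Fin k) → Dec (Proper c)
  proper? c = Fin.all? λ i → Fin.all? λ j →
    ((vertex i ≈ᵥ? vertex j) →-dec (c i Fin.≟ c j)) ×-dec (adj? (vertex i) (vertex j) →-dec ¬? (c i Fin.≟ c j))

  -- The maps from `Fin N` to `Fin k` are themselves coded by a finite type through `finToFun`, and
  -- properness of each is decidable.
  colourable? : ∀ k → Dec (Colourable G k)
  colourable? k = map′ extend restrict (Fin.any? (λ i → proper? (finToFun {k} {N} i)))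
    where
    extend : ∃[ i ] Proper (finToFun {k} {N} i) → Colourable G k
    extend (i , proper) =
      record { to = c ∘ index
             ; cong = λ x≈y → proj₁ (proper _ _)
                 (V.trans (vertex-index _) (V.trans x≈y (V.sym (vertex-index _)))) } ,
      λ x~y → proj₂ (proper _ _)
        (adj-respʳ (V.sym (vertex-index _)) (adj-sym (adj-respʳ (V.sym (vertex-index _)) (adj-sym x~y))))
      where c = finToFun {k} {N} i
    restrict : Colourable G k → ∃[ i ] Proper (finToFun {k} {N} i)
    restrict (f , proper) = funToFin c , λ i j →
      (λ x≈y → ≡.trans (same i) (≡.trans (Func.cong f x≈y) (≡.sym (same j)))) ,
      (λ x~y eq → proper x~y (≡.trans (≡.sym (same i)) (≡.trans eq (same j))))
      where
      c = Func.to f ∘ vertex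
      same = Fin.finToFun-funToFin c

  colourable⇒χ≤ : ∀ {k} → Colourable G k → χ G ≤ k
  colourable⇒χ≤ = least colourable? _

-- Enumeration of the two graphs, and -1 as a sum of two squares.

module _ {c ℓ₁ ℓ₂} (F : HeytingField c ℓ₁ ℓ₂) {n} (order : HasOrder F n) where
  open FiniteField F order
  open Solver using (solve; _:=_; _:+_; _:*_; :-_; _:-_; _:^_; con)
  open ≈-Reasoning setoid

  χ-graphG≤ : ∀ {k} → Colourable (graphG F) k → χ graphG F ≤ k
  χ-graphG≤ = FiniteGraph.colourable⇒χ≤ (graphG F) {n ℕ.* n} point index point-index
    _≈₂?_ (λ x@(x₁ , x₂) y@(y₁ , y₂) → ¬? (x ≈₂? y) ×-dec ((x₁ + y₁) ^ 2 ≈? x₂ + y₂))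
    where
    open Graph (graphG F) using (Vertex; _≈ᵥ_)
    _≈₂?_ : Decidable _≈ᵥ_
    (x₁ , x₂) ≈₂? (y₁ , y₂) = (x₁ ≈? y₁) ×-dec (x₂ ≈? y₂)
    point : Fin (n ℕ.* n) → Vertex
    point i = from (proj₁ (remQuot {n} n i)) , from (proj₂ (remQuot {n} n i))
    index : Vertex → Fin (n ℕ.* n)
    index (x₁ , x₂) = combine (to x₁) (to x₂)
    point-index : ∀ x → point (index x) ≈ᵥ x
    point-index (x₁ , x₂) =
      trans (reflexive (≡.cong (from ∘ proj₁) (Fin.remQuot-combine (to x₁) (to x₂)))) (from-to x₁) ,
      trans (reflexive (≡.cong (from ∘ proj₂) (Fin.remQuot-combine (to x₁) (to x₂)))) (from-to x₂)

  χ-graphER≤ : ∀ {k} → Colourable (graphER F) k → χ graphER F ≤ k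
  χ-graphER≤ = FiniteGraph.colourable⇒χ≤ (graphER F) {n ℕ.^ 3} line index line-index
    _≈ₗ?_ (λ x y → ¬? (x ≈ₗ? y) ×-dec (_·_ F (proj₁ x) (proj₁ y) ≈? 0#))
    where
    open Graph (graphER F) using (_≈ᵥ_)
    _∈⟨_⟩? : ∀ x y → Dec (_∈⟨_⟩ F x y)
    x ∈⟨ y ⟩? = map′ (λ (i , eq) → from i , eq)
      (λ (s , eq) → to s , λ k → trans (eq k) (*-congʳ (sym (from-to s))))
      (Fin.any? λ i → Fin.all? λ k → x k ≈? from i * y k)
    _≈ₗ?_ : Decidable _≈ᵥ_
    (x , _) ≈ₗ? (y , _) = (x ∈⟨ y ⟩?) ×-dec (y ∈⟨ x ⟩?)
    zero? : (x : Vector Carrier 3) → Dec (∀ i → x i ≈ 0#)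
    zero? x = Fin.all? (λ i → x i ≈? 0#)
    line : Fin (n ℕ.^ 3) → Line F
    line i with zero? (from ∘ finToFun {n} {3} i)
    -- The zero vector spans no line, so an arbitrary line stands in for it; `index` never produces
    -- this case.
    ... | yes _   = (λ _ → 1#) , λ 1≈0 → 1≉0 (1≈0 zero)
    ... | no  x≉0 = from ∘ finToFun {n} {3} i , x≉0
    index : Line F → Fin (n ℕ.^ 3)
    index (x , _) = funToFin (to ∘ x)
    coordinate : ∀ x i → from (finToFun {n} {3} (funToFin (to ∘ x)) i) ≈ x i
    coordinate x i = trans (reflexive (≡.cong from (Fin.finToFun-funToFin (to ∘ x) i))) (from-to (x i))
    line-index : ∀ x → line (index x) ≈ᵥ x
    line-index (x , x≉0) with zero? (from ∘ finToFun {n} {3} (funToFin (to ∘ x)))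
    ... | yes x≈0 = contradiction (λ i → trans (sym (coordinate x i)) (x≈0 i)) x≉0
    ... | no  _   = (1# , λ i → trans (coordinate x i) (sym (*-identityˡ _))) ,
                    (1# , λ i → trans (sym (coordinate x i)) (sym (*-identityˡ _)))

  module OddCharacteristic (2≉0 : ¬ 1# + 1# ≈ 0#) where

    x+x≈0⇒x≈0 : ∀ {x} → x + x ≈ 0# → x ≈ 0#
    x+x≈0⇒x≈0 {x} x+x≈0 = x≉0∧xy≈0⇒y≈0 2≉0 (trans (solve 1 (λ x → con (+ 2) :* x := x :+ x) refl x) x+x≈0)

    x*x≈y*y⇒x≈±y : ∀ {x y} → x * x ≈ y * y → x ≈ y ⊎ x ≈ - y
    x*x≈y*y⇒x≈±y {x} {y} eq with x*y≈0⇒x≈0∨y≈0 (x - y) {x + y}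
      (trans (solve 2 (λ x y → (x :- y) :* (x :+ y) := x :* x :- y :* y) refl x y) (x≈y⇒x-y≈0 eq))
    ... | inj₁ x-y≈0 = inj₁ (x-y≈0⇒x≈y x-y≈0)
    ... | inj₂ x+y≈0 = inj₂ (x-y≈0⇒x≈y (trans (+-congˡ (-‿involutive y)) x+y≈0))

    neg : Fin n → Fin n
    neg i = to (- from i)

    neg-involutive : ∀ i → neg (neg i) ≡ i
    neg-involutive i = ≡.trans (toⁱ-cong (trans (-‿cong (from-to _)) (-‿involutive _))) (to-from i)

    -- Choose one of a, -a for each a: sending the chosen ones to a² and the
    -- others to -1 - b², and one extra point to -1 - 0², gives a map from
    -- n + 1 points to F, and only collisions a² = -1 - b² are possible.
    sumOfTwoSquares : ∃₂ λ a b → 1# + (a * a + b * b) ≈ 0#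
    sumOfTwoSquares = collision (Fin.pigeonhole (ℕ.n<1+n n) (to ∘ value))
      where
      Goal = ∃₂ λ a b → 1# + (a * a + b * b) ≈ 0#
      signedSquare : ∀ i → Dec (i Fin.≤ neg i) → Carrier
      signedSquare i (yes _) = from i * from i
      signedSquare i (no  _) = - (1# + from i * from i)
      value : Fin (suc n) → Carrier
      value zero    = - 1#
      value (suc i) = signedSquare i (i Fin.≤? neg i)
      mixed : ∀ i j → from i * from i ≈ - (1# + from j * from j) → Goal
      mixed i j eq = from i , from j , trans
        (solve 3 (λ o x y → o :+ (x :+ y) := x :- (:- (o :+ y))) refl 1# _ _) (x≈y⇒x-y≈0 eq)
      plusOrMinus : ∀ i j → from i * from i ≈ from j * from j → i ≡ j ⊎ i ≡ neg j
      plusOrMinus i j eq with x*x≈y*y⇒x≈±y eq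
      ... | inj₁ i≈j  = inj₁ (from-injective i≈j)
      ... | inj₂ i≈-j = inj₂ (≡.trans (≡.sym (to-from i)) (toⁱ-cong i≈-j))
      compare : ∀ i j di dj → signedSquare i di ≈ signedSquare j dj → i ≡ j ⊎ Goal
      -- Equal squares give a = b or a = -b. In the second case the index comparisons for a and -a
      -- are reversed, so two elements on the same side of the choice must coincide.
      compare i j (yes i≤) (yes j≤) eq with plusOrMinus i j eq
      ... | inj₁ i≡j    = inj₁ i≡j
      ... | inj₂ ≡.refl = inj₁ (Fin.≤-antisym (≡.subst (neg j Fin.≤_) (neg-involutive j) i≤) j≤)
      compare i j (no i≰) (no j≰) eq
        with plusOrMinus i j (trans (solve 2 (λ o x → x := :- (:- (o :+ x)) :- o) refl 1# _)
          (trans (+-congʳ (-‿cong eq)) (sym (solve 2 (λ o x → x := :- (:- (o :+ x)) :- o) refl 1# _))))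
      ... | inj₁ i≡j    = inj₁ i≡j
      ... | inj₂ ≡.refl = contradiction (ℕ.<⇒≤ (ℕ.≰⇒> j≰))
        (λ nj≤j → i≰ (≡.subst (neg j Fin.≤_) (≡.sym (neg-involutive j)) nj≤j))
      compare i j (yes _) (no  _) eq = inj₂ (mixed i j eq)
      compare i j (no  _) (yes _) eq = inj₂ (mixed j i (sym eq))
      compare-1 : ∀ j dj → - 1# ≈ signedSquare j dj → Goal
      compare-1 j (yes _) eq = from j , 0# , trans
        (solve 1 (λ x → con (+ 1) :+ (x :+ con (+ 0) :* con (+ 0)) := x :- con -[1+ 0 ]) refl _) (x≈y⇒x-y≈0 (sym eq))
      -- Here b² = 0, so b = 0; but 0 is its own negative and therefore counts as chosen.
      compare-1 j (no j≰) eq = contradiction (ℕ.≤-reflexive (≡.cong Fin.toℕ j≡negj)) j≰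
        where
        j≈0 : from j ≈ 0#
        j≈0 = x^k≈0⇒x≈0 2 (trans
          (solve 1 (λ x → x :^ 2 := con -[1+ 0 ] :- :- (con (+ 1) :+ x :* x)) refl _) (x≈y⇒x-y≈0 eq))
        j≡negj : j ≡ neg j
        j≡negj = from-injective (trans j≈0 (sym (trans (from-to _) (trans (-‿cong j≈0) -0#≈0#))))
      collision : (∃₂ λ i j → i Fin.< j × to (value i) ≡ to (value j)) → Goal
      collision (zero  , suc j , _       , eq) = compare-1 j (j Fin.≤? neg j) (to-injective eq)
      collision (suc i , suc j , s≤s i<j , eq) with compare i j (i Fin.≤? neg i) (j Fin.≤? neg j) (to-injective eq)
      ... | inj₁ i≡j  = contradiction (≡.cong Fin.toℕ i≡j) (ℕ.<⇒≢ i<j)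
      ... | inj₂ goal = goal

-- Extending a colouring of G_Q to ER_Q by one colour.

module _ {c ℓ₁ ℓ₂} (F : HeytingField c ℓ₁ ℓ₂) {n} (order : HasOrder F n) where
  open FiniteField F order
  open Solver using (solve; _:=_; _:+_; _:*_; :-_; _:-_; _:^_; con)
  open ≈-Reasoning setoid

  -- With a² + b² = -1 the functionals below satisfy
  -- α u γ v + γ u α v + 2 β u β v = -2 u·v.  In the affine coordinates
  -- x = β/α and c = -γ/α orthogonality therefore reads 2xx′ = c + c′, which
  -- is adjacency of (x, c + x²) and (x′, c′ + x′²) in G_Q.
  module ERColouring (2≉0 : ¬ 1# + 1# ≈ 0#) (a b : Carrier) (1+a²+b²≈0 : 1# + (a * a + b * b) ≈ 0#)
    {k} (f : Func (plane F) (≡.setoid (Fin k)))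
    (f-proper : ∀ {x y : Carrier × Carrier} → AdjG F x y → Func.to f x ≢ Func.to f y) where

    V = Vector Carrier 3

    -- Dot products with (1, a, b), (0, b, -a) and (-1, a, b). The first and third vectors are
    -- isotropic with product -2; the second is orthogonal to both and has square -1.
    α β γ : V → Carrier
    α u = u 0F + (a * u 1F + b * u 2F)
    β u = b * u 1F - a * u 2F
    γ u = - u 0F + (a * u 1F + b * u 2F)

    form : ∀ u v → α u * γ v + γ u * α v + (1# + 1#) * (β u * β v) ≈ - (1# + 1#) * _·_ F u v
    form u v = begin
      α u * γ v + γ u * α v + (1# + 1#) * (β u * β v)
        -- As polynomials the two sides differ by a multiple of 1 + a² + b², kept as an explicit
        -- last term.
        ≈⟨ solve 8 (λ a b u₀ u₁ u₂ v₀ v₁ v₂ →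
             (u₀ :+ (a :* u₁ :+ b :* u₂)) :* (:- v₀ :+ (a :* v₁ :+ b :* v₂)) :+
             (:- u₀ :+ (a :* u₁ :+ b :* u₂)) :* (v₀ :+ (a :* v₁ :+ b :* v₂)) :+
             con (+ 2) :* ((b :* u₁ :- a :* u₂) :* (b :* v₁ :- a :* v₂)) :=
             :- con (+ 2) :* (u₀ :* v₀ :+ u₁ :* v₁ :+ u₂ :* v₂) :+
             con (+ 2) :* (u₁ :* v₁ :+ u₂ :* v₂) :* (con (+ 1) :+ (a :* a :+ b :* b)))
             refl a b (u 0F) (u 1F) (u 2F) (v 0F) (v 1F) (v 2F) ⟩
      - (1# + 1#) * _·_ F u v + (1# + 1#) * (u 1F * v 1F + u 2F * v 2F) * (1# + (a * a + b * b))
        ≈⟨ +-congˡ (trans (*-congˡ 1+a²+b²≈0) (zeroʳ _)) ⟩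
      - (1# + 1#) * _·_ F u v + 0#
        ≈⟨ +-identityʳ _ ⟩
      - (1# + 1#) * _·_ F u v ∎

    orthogonal : ∀ {u v} → _·_ F u v ≈ 0# → α u * γ v + γ u * α v + (1# + 1#) * (β u * β v) ≈ 0#
    orthogonal {u} {v} u⊥v = trans (form u v) (trans (*-congˡ u⊥v) (zeroʳ _))

    module _ {u v : V} {s : Carrier} (u≈sv : ∀ i → u i ≈ s * v i) where
      α-homo : α u ≈ s * α v
      α-homo = trans (+-cong (u≈sv 0F) (+-cong (*-congˡ (u≈sv 1F)) (*-congˡ (u≈sv 2F))))
        (solve 6 (λ a b s v₀ v₁ v₂ → s :* v₀ :+ (a :* (s :* v₁) :+ b :* (s :* v₂)) :=
          s :* (v₀ :+ (a :* v₁ :+ b :* v₂))) refl a b s (v 0F) (v 1F) (v 2F))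
      β-homo : β u ≈ s * β v
      β-homo = trans (+-cong (*-congˡ (u≈sv 1F)) (-‿cong (*-congˡ (u≈sv 2F))))
        (solve 5 (λ a b s v₁ v₂ → b :* (s :* v₁) :- a :* (s :* v₂) :=
          s :* (b :* v₁ :- a :* v₂)) refl a b s (v 1F) (v 2F))
      γ-homo : γ u ≈ s * γ v
      γ-homo = trans (+-cong (-‿cong (u≈sv 0F)) (+-cong (*-congˡ (u≈sv 1F)) (*-congˡ (u≈sv 2F))))
        (solve 6 (λ a b s v₀ v₁ v₂ → :- (s :* v₀) :+ (a :* (s :* v₁) :+ b :* (s :* v₂)) :=
          s :* (:- v₀ :+ (a :* v₁ :+ b :* v₂))) refl a b s (v 0F) (v 1F) (v 2F))

    -- Twice the inverse of the coordinate change u ↦ (α u, β u, γ u); the factor 2 avoids a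
    -- division.
    twice : Carrier → Carrier → Carrier → V
    twice x y z 0F = x - z
    twice x y z 1F = - (a * (x + z) + (1# + 1#) * (b * y))
    twice x y z 2F = - (b * (x + z) - (1# + 1#) * (a * y))

    twice-αβγ : ∀ u i → twice (α u) (β u) (γ u) i ≈ (1# + 1#) * u i
    twice-αβγ u 0F = solve 2 (λ x s → (x :+ s) :- (:- x :+ s) := con (+ 2) :* x) refl (u 0F) _
    twice-αβγ u 1F = trans
      (solve 5 (λ a b u₀ u₁ u₂ →
        :- (a :* ((u₀ :+ (a :* u₁ :+ b :* u₂)) :+ (:- u₀ :+ (a :* u₁ :+ b :* u₂))) :+
          con (+ 2) :* (b :* (b :* u₁ :- a :* u₂))) :=
        con (+ 2) :* u₁ :- con (+ 2) :* u₁ :* (con (+ 1) :+ (a :* a :+ b :* b)))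
        refl a b (u 0F) (u 1F) (u 2F))
      (trans (+-congˡ (-‿cong (trans (*-congˡ 1+a²+b²≈0) (zeroʳ _)))) (trans (+-congˡ -0#≈0#) (+-identityʳ _)))
    twice-αβγ u 2F = trans
      (solve 5 (λ a b u₀ u₁ u₂ →
        :- (b :* ((u₀ :+ (a :* u₁ :+ b :* u₂)) :+ (:- u₀ :+ (a :* u₁ :+ b :* u₂))) :-
          con (+ 2) :* (a :* (b :* u₁ :- a :* u₂))) :=
        con (+ 2) :* u₂ :- con (+ 2) :* u₂ :* (con (+ 1) :+ (a :* a :+ b :* b)))
        refl a b (u 0F) (u 1F) (u 2F))
      (trans (+-congˡ (-‿cong (trans (*-congˡ 1+a²+b²≈0) (zeroʳ _)))) (trans (+-congˡ -0#≈0#) (+-identityʳ _)))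

    twice-cong : ∀ {x y z x′ y′ z′} → x ≈ x′ → y ≈ y′ → z ≈ z′ → ∀ i → twice x y z i ≈ twice x′ y′ z′ i
    twice-cong p q r 0F = +-cong p (-‿cong r)
    twice-cong p q r 1F = -‿cong (+-cong (*-congˡ (+-cong p r)) (*-congˡ (*-congˡ q)))
    twice-cong p q r 2F = -‿cong (+-cong (*-congˡ (+-cong p r)) (-‿cong (*-congˡ (*-congˡ q))))

    ∈⟨⟩-αβγ : ∀ {u v} s → α u ≈ s * α v → β u ≈ s * β v → γ u ≈ s * γ v → ∀ i → u i ≈ s * v i
    ∈⟨⟩-αβγ {u} {v} s α≈ β≈ γ≈ i = *-cancelˡ 2≉0 (begin
      (1# + 1#) * u i                              ≈⟨ twice-αβγ u i ⟨
      twice (α u) (β u) (γ u) i                    ≈⟨ twice-cong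
        (trans α≈ (sym (α-homo sv))) (trans β≈ (sym (β-homo sv))) (trans γ≈ (sym (γ-homo sv))) i ⟩
      twice (α (λ i → s * v i)) (β (λ i → s * v i)) (γ (λ i → s * v i)) i ≈⟨ twice-αβγ (λ i → s * v i) i ⟩
      (1# + 1#) * (s * v i)                        ∎)
      where
      sv : ∀ i → s * v i ≈ s * v i
      sv _ = refl

    αβγ≈0 : ∀ {u} → α u ≈ 0# → β u ≈ 0# → γ u ≈ 0# → ∀ i → u i ≈ 0#
    αβγ≈0 {u} α≈0 β≈0 γ≈0 i = trans
      (∈⟨⟩-αβγ {u} {u} 0# (trans α≈0 (sym (zeroˡ _))) (trans β≈0 (sym (zeroˡ _))) (trans γ≈0 (sym (zeroˡ _))) i)
      (zeroˡ _)

    -- The line α = 0 is the polar of the isotropic point (1, a, b), which lies on it and is the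
    -- pole. `affine` carries the inverse of `α u` used to normalise coordinates.
    data Position (u : V) : Set (c ⊔ ℓ₁) where
      affine   : ∀ ι → α u * ι ≈ 1# → Position u
      infinite : α u ≈ 0# → ¬ β u ≈ 0# → Position u
      pole     : α u ≈ 0# → β u ≈ 0# → Position u

    position : ∀ u → Position u
    position u with α u ≈? 0# | β u ≈? 0#
    ... | no α≉0  | _       = let ι , eq = invertible (α u) α≉0 in affine ι eq
    ... | yes α≈0 | no β≉0  = infinite α≈0 β≉0
    ... | yes α≈0 | yes β≈0 = pole α≈0 β≈0

    affinePoint : V → Carrier → Carrier × Carrier
    affinePoint u ι = β u * ι , - (γ u * ι) + β u * ι * (β u * ι)

    -- The pole is adjacent only to points at infinity, so it may share a
    -- colour with the affine points.
    colour : ∀ {u} → Position u → Fin k ⊎ Fin 1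
    colour {u} (affine ι _)   = inj₁ (Func.to f (affinePoint u ι))
    colour     (infinite _ _) = inj₂ zero
    colour     (pole _ _)     = inj₁ (Func.to f (0# , 0#))

    invertible⇒≉0 : ∀ {x ι} → x * ι ≈ 1# → ¬ x ≈ 0#
    invertible⇒≉0 xι≈1 x≈0 = 1≉0 (trans (sym xι≈1) (trans (*-congʳ x≈0) (zeroˡ _)))

    ratio-scale : ∀ {s x y x′ y′ ι ι′} → x ≈ s * x′ → y ≈ s * y′ → y * ι ≈ 1# → y′ * ι′ ≈ 1# → x * ι ≈ x′ * ι′
    ratio-scale {s} {x} {y} {x′} {y′} {ι} {ι′} x≈ y≈ yι≈1 y′ι′≈1 = begin
      x * ι                    ≈⟨ *-congʳ x≈ ⟩
      s * x′ * ι               ≈⟨ *-identityʳ _ ⟨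
      s * x′ * ι * 1#          ≈⟨ *-congˡ y′ι′≈1 ⟨
      s * x′ * ι * (y′ * ι′)   ≈⟨ solve 5 (λ s x ι y ι′ → s :* x :* ι :* (y :* ι′) := x :* ι′ :* (s :* y :* ι))
                                    refl s x′ ι y′ ι′ ⟩
      x′ * ι′ * (s * y′ * ι)   ≈⟨ *-congˡ (trans (*-congʳ (sym y≈)) yι≈1) ⟩
      x′ * ι′ * 1#             ≈⟨ *-identityʳ _ ⟩
      x′ * ι′                  ∎

    scale≈0 : ∀ {s x y} → x ≈ s * y → y ≈ 0# → x ≈ 0#
    scale≈0 x≈sy y≈0 = trans x≈sy (trans (*-congˡ y≈0) (zeroʳ _))

    colour-cong : ∀ {u v} → _∈⟨_⟩ F u v → _∈⟨_⟩ F v u → ∀ pu pv → colour {u} pu ≡ colour {v} pv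
    colour-cong {u} {v} (s , u≈sv) _ (affine ι αι≈1) (affine ι′ αι′≈1) =
      ≡.cong inj₁ (Func.cong f
        (x≈ , +-cong (-‿cong (ratio-scale (γ-homo u≈sv) (α-homo u≈sv) αι≈1 αι′≈1)) (*-cong x≈ x≈)))
      where
      x≈ : β u * ι ≈ β v * ι′
      x≈ = ratio-scale (β-homo u≈sv) (α-homo u≈sv) αι≈1 αι′≈1
    colour-cong (s , u≈sv) _ (affine _ αι≈1) (infinite α≈0 _) =
      contradiction (scale≈0 (α-homo u≈sv) α≈0) (invertible⇒≉0 αι≈1)
    colour-cong (s , u≈sv) _ (affine _ αι≈1) (pole α≈0 _)     =
      contradiction (scale≈0 (α-homo u≈sv) α≈0) (invertible⇒≉0 αι≈1)
    colour-cong _ (t , v≈tu) (infinite α≈0 _) (affine _ αι≈1) =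
      contradiction (scale≈0 (α-homo v≈tu) α≈0) (invertible⇒≉0 αι≈1)
    colour-cong _ (t , v≈tu) (pole α≈0 _)     (affine _ αι≈1) =
      contradiction (scale≈0 (α-homo v≈tu) α≈0) (invertible⇒≉0 αι≈1)
    colour-cong _ _                  (infinite _ _)   (infinite _ _)   = ≡.refl
    colour-cong (s , u≈sv) _ (infinite _ β≉0) (pole _ β≈0)     = contradiction (scale≈0 (β-homo u≈sv) β≈0) β≉0
    colour-cong _ (t , v≈tu) (pole _ β≈0)     (infinite _ β≉0) = contradiction (scale≈0 (β-homo v≈tu) β≈0) β≉0
    colour-cong _ _ (pole _ _) (pole _ _) = ≡.refl

    affine-∈ : ∀ {u v ι ι′} → α u * ι ≈ 1# → α v * ι′ ≈ 1# →
      β u * ι ≈ β v * ι′ → γ u * ι ≈ γ v * ι′ → _∈⟨_⟩ F u v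
    affine-∈ {u} {v} {ι} {ι′} αι≈1 αι′≈1 βι≈ γι≈ =
      α u * ι′ , ∈⟨⟩-αβγ (α u * ι′) (scaled (trans αι≈1 (sym αι′≈1))) (scaled βι≈) (scaled γι≈)
      where
      scaled : ∀ {x y} → x * ι ≈ y * ι′ → x ≈ α u * ι′ * y
      scaled {x} {y} eq = begin
        x              ≈⟨ *-identityʳ x ⟨
        x * 1#         ≈⟨ *-congˡ αι≈1 ⟨
        x * (α u * ι)  ≈⟨ solve 3 (λ x a i → x :* (a :* i) := a :* (x :* i)) refl x (α u) ι ⟩
        α u * (x * ι)  ≈⟨ *-congˡ eq ⟩
        α u * (y * ι′) ≈⟨ solve 3 (λ a y i → a :* (y :* i) := a :* i :* y) refl (α u) y ι′ ⟩
        α u * ι′ * y   ∎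

    pole-∈ : ∀ {u v} → α u ≈ 0# → β u ≈ 0# → α v ≈ 0# → β v ≈ 0# → ¬ (∀ i → v i ≈ 0#) → _∈⟨_⟩ F u v
    pole-∈ {u} {v} αu≈0 βu≈0 αv≈0 βv≈0 v≉0 with ι , γι≈1 ← invertible (γ v) (v≉0 ∘ αβγ≈0 {v} αv≈0 βv≈0) =
      γ u * ι , ∈⟨⟩-αβγ (γ u * ι)
        (trans αu≈0 (sym (scale≈0 refl αv≈0)))
        (trans βu≈0 (sym (scale≈0 refl βv≈0)))
        (begin
          γ u               ≈⟨ *-identityʳ _ ⟨
          γ u * 1#          ≈⟨ *-congˡ γι≈1 ⟨
          γ u * (γ v * ι)   ≈⟨ solve 3 (λ x y i → x :* (y :* i) := x :* i :* y) refl (γ u) (γ v) ι ⟩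
          γ u * ι * γ v     ∎)

    affine-adjacent : ∀ {u v ι ι′} → α u * ι ≈ 1# → α v * ι′ ≈ 1# → _·_ F u v ≈ 0# →
      let x , y = affinePoint u ι ; x′ , y′ = affinePoint v ι′ in (x + x′) ^ 2 ≈ y + y′
    affine-adjacent {u} {v} {ι} {ι′} αι≈1 αι′≈1 u⊥v = x-y≈0⇒x≈y (begin
      (β u * ι + β v * ι′) ^ 2 - (- (γ u * ι) + β u * ι * (β u * ι) + (- (γ v * ι′) + β v * ι′ * (β v * ι′)))
        ≈⟨ solve 6 (λ b b′ g g′ i i′ →
             (b :* i :+ b′ :* i′) :^ 2 :- (:- (g :* i) :+ b :* i :* (b :* i) :+ (:- (g′ :* i′) :+ b′ :* i′ :* (b′ :* i′))) :=
             con (+ 1) :* (g′ :* i′) :+ g :* i :* con (+ 1) :+ con (+ 2) :* (b :* b′) :* (i :* i′))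
             refl (β u) (β v) (γ u) (γ v) ι ι′ ⟩
      1# * (γ v * ι′) + γ u * ι * 1# + (1# + 1#) * (β u * β v) * (ι * ι′)
        -- Homogenise: each lone 1 is replaced by `α u * ι` or `α v * ι′`, so that the bilinear form
        -- can be factored out.
        ≈⟨ +-congʳ (+-cong (*-congʳ (sym αι≈1)) (*-congˡ (sym αι′≈1))) ⟩
      α u * ι * (γ v * ι′) + γ u * ι * (α v * ι′) + (1# + 1#) * (β u * β v) * (ι * ι′)
        ≈⟨ solve 7 (λ a a′ g g′ d i i′ → a :* i :* (g′ :* i′) :+ g :* i :* (a′ :* i′) :+ d :* (i :* i′) :=
             (a :* g′ :+ g :* a′ :+ d) :* (i :* i′)) refl (α u) (α v) (γ u) (γ v) _ ι ι′ ⟩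
      (α u * γ v + γ u * α v + (1# + 1#) * (β u * β v)) * (ι * ι′)
        ≈⟨ *-congʳ (orthogonal {u} {v} u⊥v) ⟩
      0# * (ι * ι′) ≈⟨ zeroˡ _ ⟩
      0# ∎)

    -- Only `α u * γ v` survives in the form, so orthogonality would make all three coordinates of v
    -- vanish.
    affine⊥̸pole : ∀ {u v ι} → α u * ι ≈ 1# → α v ≈ 0# → β v ≈ 0# → ¬ (∀ i → v i ≈ 0#) → ¬ _·_ F u v ≈ 0#
    affine⊥̸pole {u} {v} αι≈1 αv≈0 βv≈0 v≉0 u⊥v = v≉0 (αβγ≈0 {v} αv≈0 βv≈0 (x≉0∧xy≈0⇒y≈0 (invertible⇒≉0 αι≈1) (begin
      α u * γ v                     ≈⟨ +-identityʳ _ ⟨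
      α u * γ v + 0#                ≈⟨ +-identityʳ _ ⟨
      α u * γ v + 0# + 0#           ≈⟨ +-cong (+-congˡ (scale≈0 refl αv≈0)) (scale≈0 refl (scale≈0 refl βv≈0)) ⟨
      α u * γ v + γ u * α v + (1# + 1#) * (β u * β v) ≈⟨ orthogonal {u} {v} u⊥v ⟩
      0#                            ∎)))

    -- Only `2 β u β v` survives in the form, a product of nonzero factors.
    infinite⊥̸infinite : ∀ {u v} → α u ≈ 0# → ¬ β u ≈ 0# → α v ≈ 0# → ¬ β v ≈ 0# → ¬ _·_ F u v ≈ 0#
    infinite⊥̸infinite {u} {v} αu≈0 βu≉0 αv≈0 βv≉0 u⊥v = βv≉0 (x≉0∧xy≈0⇒y≈0 βu≉0 (x≉0∧xy≈0⇒y≈0 2≉0 (begin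
      (1# + 1#) * (β u * β v)            ≈⟨ +-identityˡ _ ⟨
      0# + (1# + 1#) * (β u * β v)       ≈⟨ +-congʳ (+-identityˡ _) ⟨
      0# + 0# + (1# + 1#) * (β u * β v)  ≈⟨ +-congʳ (+-cong (trans (*-congʳ αu≈0) (zeroˡ _)) (scale≈0 refl αv≈0)) ⟨
      α u * γ v + γ u * α v + (1# + 1#) * (β u * β v) ≈⟨ orthogonal {u} {v} u⊥v ⟩
      0#                                 ∎)))

    colour-proper : ∀ {u v} → AdjER F u v → ∀ pu pv → colour {proj₁ u} pu ≢ colour {proj₁ v} pv
    colour-proper {u , _} {v , _} (u≉v , u⊥v) (affine ι αι≈1) (affine ι′ αι′≈1) eq =
      f-proper (distinct , affine-adjacent {u} {v} αι≈1 αι′≈1 u⊥v) (inj₁-injective eq)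
      where
      distinct : ¬ (β u * ι ≈ β v * ι′ × _)
      distinct (x≈x′ , y≈y′) = u≉v (affine-∈ {u} {v} αι≈1 αι′≈1 x≈x′ γι≈ ,
                                      affine-∈ {v} {u} αι′≈1 αι≈1 (sym x≈x′) (sym γι≈))
        where
        γι≈ : γ u * ι ≈ γ v * ι′
        γι≈ = begin
          γ u * ι  ≈⟨ solve 2 (λ g x → g := :- (:- g :+ x :* x) :+ x :* x) refl _ (β u * ι) ⟩
          _        ≈⟨ +-cong (-‿cong y≈y′) (*-cong x≈x′ x≈x′) ⟩
          _        ≈⟨ solve 2 (λ g x → g := :- (:- g :+ x :* x) :+ x :* x) refl _ (β v * ι′) ⟨
          γ v * ι′ ∎
    colour-proper {u , _} {v , v≉0} (_ , u⊥v) (affine _ αι≈1) (pole α≈0 β≈0) _ =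
      affine⊥̸pole {u} {v} αι≈1 α≈0 β≈0 v≉0 u⊥v
    colour-proper {u , u≉0} {v , _} (_ , u⊥v) (pole α≈0 β≈0) (affine _ αι≈1) _ =
      affine⊥̸pole {v} {u} αι≈1 α≈0 β≈0 u≉0 (trans (·-comm F v u) u⊥v)
    colour-proper {u , _} {v , _} (_ , u⊥v) (infinite αu≈0 βu≉0) (infinite αv≈0 βv≉0) _ =
      infinite⊥̸infinite {u} {v} αu≈0 βu≉0 αv≈0 βv≉0 u⊥v
    colour-proper {u , u≉0} {v , v≉0} (u≉v , _) (pole αu≈0 βu≈0) (pole αv≈0 βv≈0) _ =
      u≉v (pole-∈ {u} {v} αu≈0 βu≈0 αv≈0 βv≈0 v≉0 , pole-∈ {v} {u} αv≈0 βv≈0 αu≈0 βu≈0 u≉0)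
    -- These pairs can be adjacent, but their colours lie in different summands.
    colour-proper _ (affine _ _)   (infinite _ _) ()
    colour-proper _ (infinite _ _) (affine _ _)   ()
    colour-proper _ (infinite _ _) (pole _ _)     ()
    colour-proper _ (pole _ _)     (infinite _ _) ()

    graphER-colourable : Colourable (graphER F) (k ℕ.+ 1)
    graphER-colourable =
      record { to = λ (u , _) → join k 1 (colour (position u))
             ; cong = λ {(u , _)} {(v , _)} (u∈v , v∈u) →
                 ≡.cong (join k 1) (colour-cong u∈v v∈u (position u) (position v)) } ,
      λ {u} {v} u~v eq → colour-proper {u} {v} u~v (position (proj₁ u)) (position (proj₁ v))
        (≡.trans (≡.sym (Fin.splitAt-join k 1 _)) (≡.trans (≡.cong (splitAt k) eq) (Fin.splitAt-join k 1 _)))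

-- The colouring of G_Q for Q = q³.

colour-count : ∀ s → let q = suc (suc s) in
  1 ℕ.+ (suc (suc q ℕ.* q) ℕ.* 2 ℕ.+ q ℕ.* q) ℕ.≤ 6 ℕ.* q ℕ.^ 2
colour-count s = let q = suc (suc s) in ≡.subst (1 ℕ.+ (suc (suc q ℕ.* q) ℕ.* 2 ℕ.+ q ℕ.* q) ℕ.≤_)
  -- The slack is 3q² - 2q - 3; substituting q = 2 + s makes all its coefficients positive.
  (solve 1 (λ s → let q = con 2 :+ s in
      con 1 :+ ((con 1 :+ (con 1 :+ q) :* q) :* con 2 :+ q :* q) :+ (con 5 :+ con 10 :* s :+ con 3 :* (s :* s))
      := con 6 :* q :^ 2)
    ≡.refl s)
  (ℕ.m≤m+n _ _)
  where open +-*-Solver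

-- q = 2 + s, and n - 1 = q³ - 1 = (1 + s) M.
module GColouring {c ℓ₁ ℓ₂} (F : HeytingField c ℓ₁ ℓ₂) (s : ℕ) where
  q M n : ℕ
  q = suc (suc s)
  M = suc (suc q ℕ.* q)
  n = suc (suc s ℕ.* M)

  module _ (order : HasOrder F n) where
    open FiniteField F order

    module _ (2≉0 : ¬ 1# + 1# ≈ 0#) (^q-distrib-+ : ∀ x y → (x + y) ^ q ≈ x ^ q + y ^ q) where
      open OddCharacteristic F order 2≉0
      open Solver using (solve; _:=_; _:+_; _:*_; :-_; _:-_; _:^_; con)
      open ≈-Reasoning setoid

      Eigenvalue : Carrier → Carrier → Set ℓ₁
      Eigenvalue z x = x ^ q ≈ z * x

      eigenvalue : ∀ x → ∃[ i ] Eigenvalue (from i) x × from i ^ M ≈ 1#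
      eigenvalue x with x ≈? 0#
      -- Every z satisfies the equation at x = 0; the root of unity 1 is taken as default.
      ... | yes x≈0 = to 1# ,
        trans (*-congʳ x≈0) (trans (zeroˡ _) (sym (trans (*-congˡ x≈0) (zeroʳ _)))) ,
        trans (^-congˡ M (from-to 1#)) (1^k≈1 M)
        where
        1^k≈1 : ∀ k → 1# ^ k ≈ 1#
        1^k≈1 zero    = refl
        1^k≈1 (suc k) = trans (*-identityˡ _) (1^k≈1 k)
      ... | no x≉0 = to (x ^ suc s) ,
        trans (*-comm x (x ^ suc s)) (*-congʳ (sym (from-to _))) ,
        trans (^-congˡ M (from-to _)) (trans (^-assocʳ x (suc s) M) (fermat F order x x≉0))

      unityPolynomial : Vec Carrier M
      unityPolynomial = - 1# ∷ replicate (suc q ℕ.* q) 0#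

      unity-root : ∀ {i} → from i ^ M ≈ 1# → Root unityPolynomial i
      unity-root {i} i^M≈1 = trans (+-congˡ (trans (*-congˡ (⟦replicate⟧ (suc q ℕ.* q) (from i))) i^M≈1)) (-‿inverseˡ 1#)

      -- X^q - zX; its two leading entries are why q is written as 2 + s.
      eigenPolynomial : Carrier → Vec Carrier q
      eigenPolynomial z = 0# ∷ - z ∷ replicate s 0#

      eigen-root : ∀ {z x} → Eigenvalue z x → Root (eigenPolynomial z) (to x)
      eigen-root {z} {x} x^q≈zx = begin
        0# + y * (- z + y * ⟦ replicate s 0# ⟧ y) ≈⟨ +-congˡ (*-congˡ (+-congˡ (*-congˡ (⟦replicate⟧ s y)))) ⟩
        0# + y * (- z + y * y ^ s)
          ≈⟨ solve 3 (λ y z t → con (+ 0) :+ y :* (:- z :+ y :* t) := y :* (y :* t) :- z :* y)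
               refl y z (y ^ s) ⟩
        y ^ q - z * y              ≈⟨ +-cong (^-congˡ q (from-to x)) (-‿cong (*-congˡ (from-to x))) ⟩
        x ^ q - z * x              ≈⟨ x≈y⇒x-y≈0 x^q≈zx ⟩
        0#                         ∎
        where y = from (to x)

      -- For a fixed z, an additive map killing xy whenever x^q = zx and y^q = zy.
      τ : Carrier → Carrier → Carrier
      τ z a = a ^ q - z * z * a

      -- `special` excludes the origin because the proof that adjacent special points share z fails
      -- there.
      data Kind (x a : Carrier) : Set ℓ₁ where
        origin  : x ≈ 0# → a ≈ 0# → Kind x a
        generic : ∀ i → Eigenvalue (from i) x → from i ^ M ≈ 1# → ¬ τ (from i) a ≈ 0# → Kind x a
        special : ∀ i → Eigenvalue (from i) x → from i ^ M ≈ 1# → Eigenvalue (from i * from i) a →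
                  ¬ (x ≈ 0# × a ≈ 0#) → Kind x a

      kind : ∀ x a → Kind x a
      kind x a with eigenvalue x
      ... | i , x^q≈zx , z^M≈1 with τ (from i) a ≈? 0#
      ...   | no τ≉0 = generic i x^q≈zx z^M≈1 τ≉0
      ...   | yes τ≈0 with x ≈? 0# | a ≈? 0#
      ...     | yes x≈0 | yes a≈0 = origin x≈0 a≈0
      ...     | no x≉0  | _       = special i x^q≈zx z^M≈1 (x-y≈0⇒x≈y τ≈0) (x≉0 ∘ proj₁)
      ...     | yes _   | no a≉0  = special i x^q≈zx z^M≈1 (x-y≈0⇒x≈y τ≈0) (a≉0 ∘ proj₂)

      sign : Carrier → Fin 2
      sign t with to t Fin.<? to (- t)
      ... | yes _ = 0F
      ... | no  _ = 1F

      -- For u = -t the two index comparisons are mirror images. They agree only if the indices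
      -- coincide, and then 2t = 0.
      sign-≡ : ∀ {t u} → sign t ≡ sign u → t + u ≈ 0# → t ≈ 0#
      sign-≡ {t} {u} eq t+u≈0 with to t Fin.<? to (- t) | to u Fin.<? to (- u)
      ... | yes t<-t | yes u<-u = contradiction u<-u (ℕ.<-asym (≡.subst₂ Fin._<_ t≡-u -t≡u t<-t))
        where
        t≈-u = x-y≈0⇒x≈y (trans (+-congˡ (-‿involutive u)) t+u≈0)
        t≡-u = toⁱ-cong t≈-u
        -t≡u = toⁱ-cong (trans (-‿cong t≈-u) (-‿involutive u))
      ... | no t≮-t | no u≮-u = x+x≈0⇒x≈0 (trans (+-congˡ t≈u) t+u≈0)
        where
        t≈-u = x-y≈0⇒x≈y (trans (+-congˡ (-‿involutive u)) t+u≈0)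
        t≡-u = toⁱ-cong t≈-u
        -t≡u = toⁱ-cong (trans (-‿cong t≈-u) (-‿involutive u))
        t≈u : t ≈ u
        t≈u = to-injective (Fin.≤-antisym (≡.subst (Fin._≤ to u) (≡.sym t≡-u) (ℕ.≮⇒≥ u≮-u))
          (≡.subst (Fin._≤ to t) -t≡u (ℕ.≮⇒≥ t≮-t)))
      ... | yes _ | no _  = contradiction eq λ ()
      ... | no _  | yes _ = contradiction eq λ ()

      Colour : Set
      Colour = Fin 1 ⊎ (Fin M × Fin 2 ⊎ Fin q × Fin q)

      colour : ∀ {x a} → Kind x a → Colour
      colour (origin _ _)                   = inj₁ zero
      colour {_} {a} (generic i _ z^M≈1 _)  = inj₂ (inj₁
        ( rank unityPolynomial (unity-root {i} z^M≈1)
        , sign (τ (from i) a)))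
      colour (special i x^q≈zx _ a^q≈z²a _) = inj₂ (inj₂
        ( rank (eigenPolynomial (from i)) (eigen-root x^q≈zx)
        , rank (eigenPolynomial (from i * from i)) (eigen-root a^q≈z²a)))

      unity≉0 : ∀ {z} → z ^ M ≈ 1# → ¬ z ≈ 0#
      unity≉0 z^M≈1 z≈0 = 1≉0 (trans (sym z^M≈1) (trans (*-congʳ z≈0) (zeroˡ _)))

      -- As M = 1 + (q + 1)q, a root of unity z is the inverse of (z^(q+1))^q.
      unity-^[1+q]-injective : ∀ {z w} → z ^ M ≈ 1# → w ^ M ≈ 1# → z ^ suc q ≈ w ^ suc q → z ≈ w
      unity-^[1+q]-injective {z} {w} z^M≈1 w^M≈1 eq = *-cancelˡ Z≉0 (begin
        Z * z   ≈⟨ *-comm Z z ⟩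
        z * Z   ≈⟨ expand z ⟩
        z ^ M   ≈⟨ trans z^M≈1 (sym w^M≈1) ⟩
        w ^ M   ≈⟨ expand w ⟨
        w * (w ^ suc q) ^ q ≈⟨ *-congˡ (^-congˡ q eq) ⟨
        w * Z   ≈⟨ *-comm w Z ⟩
        Z * w   ∎)
        where
        Z = (z ^ suc q) ^ q
        Z≉0 : ¬ Z ≈ 0#
        Z≉0 Z≈0 = unity≉0 z^M≈1 (x^k≈0⇒x≈0 (suc q) (x^k≈0⇒x≈0 q Z≈0))
        expand : ∀ t → t * (t ^ suc q) ^ q ≈ t ^ M
        expand t = *-congˡ (^-assocʳ t (suc q) q)

      -- The q-th power of za is z^(q+1) · za, and likewise for wb; since za = wb, the two
      -- multipliers agree on this element.
      eigenvalue-powers : ∀ {z w a b} → z * a ≈ w * b → Eigenvalue (z * z) a → Eigenvalue (w * w) b →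
        z * a * (z ^ suc q - w ^ suc q) ≈ 0#
      eigenvalue-powers {z} {w} {a} {b} za≈wb a^q≈z²a b^q≈w²b = begin
        z * a * (z * z′ - w * w′)
          ≈⟨ solve 5 (λ z a z′ w w′ → z :* a :* (z :* z′ :- w :* w′) :=
               z′ :* (z :* z :* a) :- w :* w′ :* (z :* a))
               refl z a z′ w w′ ⟩
        z′ * (z * z * a) - w * w′ * (z * a)
          ≈⟨ +-congˡ (-‿cong (*-congˡ za≈wb)) ⟩
        z′ * (z * z * a) - w * w′ * (w * b)
          ≈⟨ +-congˡ (-‿cong (solve 3 (λ w w′ b → w :* w′ :* (w :* b) := w′ :* (w :* w :* b)) refl w w′ b)) ⟩
        z′ * (z * z * a) - w′ * (w * w * b)
          ≈⟨ +-cong (*-congˡ a^q≈z²a) (-‿cong (*-congˡ b^q≈w²b)) ⟨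
        z′ * a ^ q - w′ * b ^ q
          ≈⟨ +-cong (^-distrib-* z a q) (-‿cong (^-distrib-* w b q)) ⟨
        (z * a) ^ q - (w * b) ^ q
          ≈⟨ x≈y⇒x-y≈0 (^-congˡ q za≈wb) ⟩
        0# ∎
        where
        z′ = z ^ q
        w′ = w ^ q

      module _ {x y a b} (2xy≈a+b : x * y + x * y ≈ a + b) where

        a^q+b^q : ∀ {z w} → Eigenvalue z x → Eigenvalue w y → a ^ q + b ^ q ≈ z * w * (a + b)
        a^q+b^q {z} {w} x^q≈zx y^q≈wy = begin
          a ^ q + b ^ q                       ≈⟨ ^q-distrib-+ a b ⟨
          (a + b) ^ q                         ≈⟨ ^-congˡ q 2xy≈a+b ⟨
          (x * y + x * y) ^ q                 ≈⟨ ^q-distrib-+ (x * y) (x * y) ⟩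
          (x * y) ^ q + (x * y) ^ q           ≈⟨ +-cong xy^q xy^q ⟩
          z * x * (w * y) + z * x * (w * y)   ≈⟨ distribˡ (z * x) (w * y) (w * y) ⟨
          z * x * (w * y + w * y)
            ≈⟨ solve 4 (λ z x w y → z :* x :* (w :* y :+ w :* y) := z :* w :* (x :* y :+ x :* y))
                 refl z x w y ⟩
          z * w * (x * y + x * y)             ≈⟨ *-congˡ 2xy≈a+b ⟩
          z * w * (a + b)                     ∎
          where
          xy^q : (x * y) ^ q ≈ z * x * (w * y)
          xy^q = trans (^-distrib-* x y q) (*-cong x^q≈zx y^q≈wy)

        τ-sum : ∀ {z} → Eigenvalue z x → Eigenvalue z y → τ z a + τ z b ≈ 0#
        τ-sum {z} x^q≈zx y^q≈zy = begin
          a ^ q - z * z * a + (b ^ q - z * z * b)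
            ≈⟨ solve 5 (λ z a b a′ b′ → a′ :- z :* z :* a :+ (b′ :- z :* z :* b) :=
                 (a′ :+ b′) :- z :* z :* (a :+ b))
                 refl z a b (a ^ q) (b ^ q) ⟩
          (a ^ q + b ^ q) - z * z * (a + b)       ≈⟨ x≈y⇒x-y≈0 (a^q+b^q x^q≈zx y^q≈zy) ⟩
          0#                                      ∎

        -- Two evaluations of a^q + b^q give z²a + w²b = zw(a + b), whose difference factors.
        special-dichotomy : ∀ {z w} → Eigenvalue z x → Eigenvalue (z * z) a → Eigenvalue w y → Eigenvalue (w * w) b →
          w - z ≈ 0# ⊎ z * a - w * b ≈ 0#
        special-dichotomy {z} {w} x^q≈zx a^q≈z²a y^q≈wy b^q≈w²b = x*y≈0⇒x≈0∨y≈0 (w - z) (begin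
          (w - z) * (z * a - w * b)
            ≈⟨ solve 4 (λ z w a b → (w :- z) :* (z :* a :- w :* b) :=
                 z :* w :* (a :+ b) :- (z :* z :* a :+ w :* w :* b))
                 refl z w a b ⟩
          z * w * (a + b) - (z * z * a + w * w * b)
            ≈⟨ x≈y⇒x-y≈0 (trans (sym (a^q+b^q x^q≈zx y^q≈wy)) (+-cong a^q≈z²a b^q≈w²b)) ⟩
          0# ∎)

        -- If z ≠ w then za = wb; applying t ↦ t^q to this gives z^(q+1) = w^(q+1) unless za = 0.
        special-eigenvalues : ∀ {z w} → Eigenvalue z x → z ^ M ≈ 1# → Eigenvalue (z * z) a → ¬ (x ≈ 0# × a ≈ 0#) →
          Eigenvalue w y → w ^ M ≈ 1# → Eigenvalue (w * w) b → ¬ (y ≈ 0# × b ≈ 0#) → z ≈ w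
        special-eigenvalues {z} {w} x^q≈zx z^M≈1 a^q≈z²a x,a≉0 y^q≈wy w^M≈1 b^q≈w²b y,b≉0 =
          [ (λ w-z≈0 → sym (x-y≈0⇒x≈y w-z≈0))
          , (λ za-wb≈0 → let za≈wb = x-y≈0⇒x≈y za-wb≈0 in
              [ (λ za≈0 → contradiction (za≈0 , trans (sym za≈wb) za≈0) za,wb≉0)
              , (λ eq → unity-^[1+q]-injective z^M≈1 w^M≈1 (x-y≈0⇒x≈y eq))
              ]′ (x*y≈0⇒x≈0∨y≈0 (z * a) (eigenvalue-powers za≈wb a^q≈z²a b^q≈w²b)))
          ]′ (special-dichotomy x^q≈zx a^q≈z²a y^q≈wy b^q≈w²b)
          where
          -- If both products vanish, then a = b = 0, so 2xy = 0 and one of the two points is the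
          -- origin.
          za,wb≉0 : ¬ (z * a ≈ 0# × w * b ≈ 0#)
          za,wb≉0 (za≈0 , wb≈0) = [ (λ x≈0 → x,a≉0 (x≈0 , a≈0)) , (λ y≈0 → y,b≉0 (y≈0 , b≈0)) ]′ (x*y≈0⇒x≈0∨y≈0 x xy≈0)
            where
            a≈0 : a ≈ 0#
            a≈0 = x≉0∧xy≈0⇒y≈0 (unity≉0 z^M≈1) za≈0
            b≈0 : b ≈ 0#
            b≈0 = x≉0∧xy≈0⇒y≈0 (unity≉0 w^M≈1) wb≈0
            xy≈0 : x * y ≈ 0#
            xy≈0 = x+x≈0⇒x≈0 (trans 2xy≈a+b (trans (+-cong a≈0 b≈0) (+-identityˡ 0#)))

        generic-conflict : ∀ {i j} → i ≡ j → Eigenvalue (from i) x → Eigenvalue (from j) y →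
          sign (τ (from i) a) ≡ sign (τ (from j) b) → τ (from i) a ≈ 0#
        generic-conflict ≡.refl x^q≈zx y^q≈zy same-sign = sign-≡ same-sign (τ-sum x^q≈zx y^q≈zy)

        -- Matching on `i ≡ j` identifies the polynomials, so that both ranks refer to the same list
        -- of roots.
        special-equal : ∀ {i j} → i ≡ j →
          (x^q : Eigenvalue (from i) x) (a^q : Eigenvalue (from i * from i) a)
          (y^q : Eigenvalue (from j) y) (b^q : Eigenvalue (from j * from j) b) →
          rank (eigenPolynomial (from i)) (eigen-root x^q) ≡ rank (eigenPolynomial (from j)) (eigen-root y^q) →
          rank (eigenPolynomial (from i * from i)) (eigen-root a^q) ≡ rank (eigenPolynomial (from j * from j)) (eigen-root b^q) →
          x ≈ y × a ≈ b
        special-equal {i} ≡.refl x^q a^q y^q b^q same-x same-a =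
          to-injective (rank-injective (eigenPolynomial (from i)) (eigen-root x^q) (eigen-root y^q) same-x) ,
          to-injective (rank-injective (eigenPolynomial (from i * from i)) (eigen-root a^q) (eigen-root b^q) same-a)

        -- The relation 2xy = a + b also holds between a point and itself when a = x². Equal colours
        -- are therefore shown to give equal points, which the distinctness clause of adjacency then
        -- refutes.
        colour-proper : (κ : Kind x a) (κ′ : Kind y b) → colour κ ≡ colour κ′ → x ≈ y × a ≈ b
        colour-proper (origin x≈0 a≈0) (origin y≈0 b≈0) _ = trans x≈0 (sym y≈0) , trans a≈0 (sym b≈0)
        colour-proper (generic i x^q≈zx z^M≈1 τa≉0) (generic j y^q≈wy w^M≈1 τb≉0) eq =
          contradiction (generic-conflict i≡j x^q≈zx y^q≈wy (≡.cong proj₂ same)) τa≉0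
          where
          same = inj₁-injective (inj₂-injective eq)
          i≡j : i ≡ j
          i≡j = rank-injective unityPolynomial (unity-root z^M≈1) (unity-root w^M≈1) (≡.cong proj₁ same)
        colour-proper (special i x^q≈zx z^M≈1 a^q≈z²a x,a≉0) (special j y^q≈wy w^M≈1 b^q≈w²b y,b≉0) eq =
          special-equal i≡j x^q≈zx a^q≈z²a y^q≈wy b^q≈w²b (≡.cong proj₁ same) (≡.cong proj₂ same)
          where
          same = inj₂-injective (inj₂-injective eq)
          i≡j : i ≡ j
          i≡j = from-injective (special-eigenvalues x^q≈zx z^M≈1 a^q≈z²a x,a≉0 y^q≈wy w^M≈1 b^q≈w²b y,b≉0)
        colour-proper (origin _ _)        (generic _ _ _ _)   ()
        colour-proper (origin _ _)        (special _ _ _ _ _) ()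
        colour-proper (generic _ _ _ _)   (origin _ _)        ()
        colour-proper (generic _ _ _ _)   (special _ _ _ _ _) ()
        colour-proper (special _ _ _ _ _) (origin _ _)        ()
        colour-proper (special _ _ _ _ _) (generic _ _ _ _)   ()

      Fin↔Colour : Fin (1 ℕ.+ (M ℕ.* 2 ℕ.+ q ℕ.* q)) ↔ Colour
      Fin↔Colour = (↔-id _ ⊎-↔ ((Fin.*↔× ⊎-↔ Fin.*↔×) ↔-∘ Fin.+↔⊎)) ↔-∘ Fin.+↔⊎

      bound : 1 ℕ.+ (M ℕ.* 2 ℕ.+ q ℕ.* q) ℕ.≤ 6 ℕ.* q ℕ.^ 2
      bound = colour-count s

      -- With x = x₁ and a = x₂ - x₁² adjacency becomes 2xy = a + b.
      code : Carrier × Carrier → Colour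
      -- Passing through indices picks canonical representatives, so equivalent points get identical
      -- colours.
      code (x₁ , x₂) = colour (kind (from (to x₁)) (from (to (x₂ - x₁ * x₁))))

      graphG-colourable : Colourable (graphG F) (6 ℕ.* q ℕ.^ 2)
      graphG-colourable =
        record { to = encode ∘ code
               ; cong = λ {(x₁ , x₂)} {(y₁ , y₂)} (x₁≈y₁ , x₂≈y₂) → ≡.cong encode
                   (≡.cong₂ (λ i j → colour (kind (from i) (from j))) (toⁱ-cong x₁≈y₁)
                     (toⁱ-cong (+-cong x₂≈y₂ (-‿cong (*-cong x₁≈y₁ x₁≈y₁))))) } ,
        λ {x} {y} x~y eq → proper x y x~y (encode-injective eq)
        where
        encode : Colour → Fin (6 ℕ.* q ℕ.^ 2)
        encode κ = inject≤ (Inverse.from Fin↔Colour κ) bound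
        encode-injective : ∀ {κ κ′} → encode κ ≡ encode κ′ → κ ≡ κ′
        encode-injective {κ} {κ′} eq = ≡.trans (≡.sym (Inverse.strictlyInverseˡ Fin↔Colour κ))
          (≡.trans (≡.cong (Inverse.to Fin↔Colour) (Fin.inject≤-injective bound bound _ _ eq))
            (Inverse.strictlyInverseˡ Fin↔Colour κ′))
        proper : ∀ x y → AdjG F x y → code x ≢ code y
        proper (x₁ , x₂) (y₁ , y₂) (x≉y , adj) eq = x≉y (x₁≈y₁ , x₂≈y₂)
          where
          a = x₂ - x₁ * x₁
          b = y₂ - y₁ * y₁
          2xy≈a+b : x₁ * y₁ + x₁ * y₁ ≈ a + b
          2xy≈a+b = x-y≈0⇒x≈y (begin
            x₁ * y₁ + x₁ * y₁ - (a + b)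
              ≈⟨ solve 4 (λ x₁ x₂ y₁ y₂ → x₁ :* y₁ :+ x₁ :* y₁ :- (x₂ :- x₁ :* x₁ :+ (y₂ :- y₁ :* y₁)) :=
                   (x₁ :+ y₁) :^ 2 :- (x₂ :+ y₂))
                   refl x₁ x₂ y₁ y₂ ⟩
            (x₁ + y₁) ^ 2 - (x₂ + y₂)
              ≈⟨ x≈y⇒x-y≈0 adj ⟩
            0# ∎)
          xy-from-to = *-cong (from-to x₁) (from-to y₁)
          same = colour-proper
            (trans (+-cong xy-from-to xy-from-to) (trans 2xy≈a+b (sym (+-cong (from-to a) (from-to b)))))
            (kind (from (to x₁)) (from (to a))) (kind (from (to y₁)) (from (to b))) eq
          x₁≈y₁ : x₁ ≈ y₁
          x₁≈y₁ = trans (sym (from-to x₁)) (trans (proj₁ same) (from-to y₁))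
          x₂≈y₂ : x₂ ≈ y₂
          x₂≈y₂ = begin
            x₂          ≈⟨ solve 2 (λ x₁ x₂ → x₂ := x₂ :- x₁ :* x₁ :+ x₁ :* x₁) refl x₁ x₂ ⟩
            a + x₁ * x₁ ≈⟨ +-cong (trans (sym (from-to a)) (trans (proj₂ same) (from-to b))) (*-cong x₁≈y₁ x₁≈y₁) ⟩
            b + y₁ * y₁ ≈⟨ solve 2 (λ x₁ x₂ → x₂ := x₂ :- x₁ :* x₁ :+ x₁ :* x₁) refl y₁ y₂ ⟨
            y₂          ∎

-- Odd characteristic, and the passage from prime powers to the bounds.

module _ {c ℓ₁ ℓ₂} (F : HeytingField c ℓ₁ ℓ₂) {n} (order : HasOrder F n) where
  open FiniteField F order

  -- An odd p is 1 + 2⌊p/2⌋, so 2 = 0 would turn p · 1 = 0 into 1 = 0.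
  p×1≈0⇒2≉0 : ∀ {p} → Prime p → p ≢ 2 → p ×ⁿ 1# ≈ 0# → ¬ 1# + 1# ≈ 0#
  p×1≈0⇒2≉0 {p} pr p≢2 p×1≈0 2≈0 with p ℕ.% 2 in p%2 | ℕ.m%n<n p 2
  ... | 0 | _ = [ (λ ()) , (λ 2≡p → p≢2 (≡.sym 2≡p)) ]′ (prime⇒irreducible pr (m%n≡0⇒n∣m p 2 p%2))
  ... | 1 | _ = 1≉0 (begin
    1#                                    ≈⟨ +-identityʳ 1# ⟨
    1 ×ⁿ 1#                               ≈⟨ +-identityʳ _ ⟨
    1 ×ⁿ 1# + 0#                          ≈⟨ +-congˡ (trans (*-congˡ (trans (+-congˡ (+-identityʳ 1#)) 2≈0)) (zeroʳ _)) ⟨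
    1 ×ⁿ 1# + (p ℕ./ 2) ×ⁿ 1# * 2 ×ⁿ 1#   ≈⟨ +-congˡ (×1-homo-* (p ℕ./ 2) 2) ⟨
    1 ×ⁿ 1# + (p ℕ./ 2 ℕ.* 2) ×ⁿ 1#       ≈⟨ ×-homo-+ 1# 1 (p ℕ./ 2 ℕ.* 2) ⟨
    (1 ℕ.+ p ℕ./ 2 ℕ.* 2) ×ⁿ 1#           ≡⟨ ≡.cong (λ r → (r ℕ.+ p ℕ./ 2 ℕ.* 2) ×ⁿ 1#) p%2 ⟨
    (p ℕ.% 2 ℕ.+ p ℕ./ 2 ℕ.* 2) ×ⁿ 1#     ≡⟨ ≡.cong (_×ⁿ 1#) (ℕ.m≡m%n+[m/n]*n p 2) ⟨
    p ×ⁿ 1#                               ≈⟨ p×1≈0 ⟩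
    0#                                    ∎)
    where open ≈-Reasoning setoid
  ... | suc (suc _) | s≤s (s≤s ())

open import Data.Nat.Base using (_+_; _*_; _^_)

module _ {c ℓ₁ ℓ₂} (F : HeytingField c ℓ₁ ℓ₂) {n} (order : HasOrder F n) where
  open FiniteField F order using (_≈_; 0#; 1#) renaming (_+_ to _⊕_)

  χ-bounds : ¬ 1# ⊕ 1# ≈ 0# → ∀ {k} → Colourable (graphG F) k → (χ graphG F ≤ k) × (χ graphER F ≤ k + 1)
  χ-bounds 2≉0 {k} (f , f-proper) = χ-graphG≤ F order (f , f-proper) , χ-graphER≤ F order
    (graphER-colourable (sumOfTwoSquares F order 2≉0))
    where
    open OddCharacteristic using (sumOfTwoSquares)
    graphER-colourable : (∃₂ λ a b → _) → Colourable (graphER F) (k + 1)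
    graphER-colourable (a , b , 1+a²+b²≈0) =
      ERColouring.graphER-colourable F order 2≉0 a b 1+a²+b²≈0 f f-proper

  module _ {p} (pr : Prime p) (p×1≈0 : FiniteField._×ⁿ_ F order p 1# ≈ 0#) where
    open FiniteField F order using () renaming (_^_ to _^ᶠ_)
    open FiniteField.Frobenius F order pr p×1≈0 using (^p^-distrib-+)

    ^q-distrib-+ : ∀ {q} k → q ≡ p ^ k → ∀ x y → (x ⊕ y) ^ᶠ q ≈ x ^ᶠ q ⊕ y ^ᶠ q
    ^q-distrib-+ k ≡.refl = ^p^-distrib-+ k

module _ {c ℓ₁ ℓ₂} (F : HeytingField c ℓ₁ ℓ₂) {s : ℕ} where
  open GColouring F s using (q; n; graphG-colourable)

  χ-bounds′ : (order : HasOrder F n) → ∀ {p} k → Prime p → p ≢ 2 → q ≡ p ^ k → n ≡ p ^ (k * 3) →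
    (χ graphG F ≤ 6 * q ^ 2) × (χ graphER F ≤ 6 * q ^ 2 + 1)
  χ-bounds′ order {p} k pr p≢2 q≡p^k n≡p^3k =
    χ-bounds F order 2≉0 (graphG-colourable order 2≉0 (^q-distrib-+ F order pr p×1≈0 k q≡p^k))
    where
    p×1≈0 = FiniteField.n≡p^k⇒p×1≈0 F order p (k * 3) n≡p^3k
    2≉0 = p×1≈0⇒2≉0 F order pr p≢2 p×1≈0

1<p^k : ∀ {p k} → Prime p → 0 ℕ.< k → 1 ℕ.< p ^ k
1<p^k {p} {suc k} pr _ = ℕ.<-≤-trans (ℕ.nonTrivial⇒n>1 p) (ℕ.m≤m*n p (p ^ k) {{ℕ.m^n≢0 p k}})
  where instance
    p-nonTrivial = prime⇒nonTrivial pr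
    p-nonZero = ℕ.nonTrivial⇒nonZero p

-- The factorisation q³ - 1 = (q - 1)(q² + q + 1), in the shape in which `fermat` reads off the
-- exponent.
[2+s]³ : ∀ s → let q = suc (suc s) in q ^ 3 ≡ suc (suc s * suc (suc q * q))
[2+s]³ = solve 1 (λ s → let q = con 2 :+ s in
  q :^ 3 := con 1 :+ (con 1 :+ s) :* (con 1 :+ (con 1 :+ q) :* q)) ≡.refl
  where open +-*-Solver

prime-power-bounds : ∀ {c ℓ₁ ℓ₂ p} q k → Prime p → p ≢ 2 → 1 ℕ.< q → q ≡ p ^ k →
  (F : HeytingField c ℓ₁ ℓ₂) → HasOrder F (q ^ 3) → (χ graphG F ≤ 6 * q ^ 2) × (χ graphER F ≤ 6 * q ^ 2 + 1)
prime-power-bounds {p = p} (suc (suc s)) k pr p≢2 _ q≡p^k F order =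
  χ-bounds′ F (≡.subst (HasOrder F) ([2+s]³ s) order) k pr p≢2 q≡p^k
    (≡.trans (≡.sym ([2+s]³ s)) (≡.trans (≡.cong (_^ 3) q≡p^k) (ℕ.^-*-assoc p k 3)))
prime-power-bounds (suc zero) _ _ _ (s≤s ())

theorem5p1 : ∀ {c ℓ₁ ℓ₂} (q : ℕ) → IsOddPrimePower q →
    (F : HeytingField c ℓ₁ ℓ₂) → HasOrder F (q ^ 3) →
    (χ graphG F ≤ 6 * q ^ 2) × (χ graphER F ≤ 6 * q ^ 2 + 1)
theorem5p1 q (p , k , pr , p≢2 , 0<k , q≡p^k) =
  prime-power-bounds q k pr p≢2 (≡.subst (1 ℕ.<_) (≡.sym q≡p^k) (1<p^k pr 0<k)) q≡p^k
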